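{- Let $c_*=\dfrac{1}{40000000010006048640}$. For every prime $p$, every set $A\subseteq \mathbb Z/p\mathbb Z$ with $|A|\ge 2$ and no unique sum satisfies $$|A|\ge c_*\,\log p\,\log\log p .$$ Consequently, $m(p)\gg \log p\,\log\log p$, i.e. there is an absolute constant $c>0$ such that $m(p)\ge c\,\log p\,\log\log p$ for every odd prime $p$.
   Context: All logarithms are natural. For an abelian group $G$ and $A\subseteq G$, the set $A$ has no unique sum if for all $a,b\in A$ there are $c,d\in A$ with $a+b=c+d$ and not ($(a=c$ and $b=d)$ or $(a=d$ and $b=c)$); i.e. no element of $A+A$ has exactly one representation as the sum of an unordered pair (two-element multiset, repetition allowed) of elements of $A$. For a prime $p\ge 3$, $m(p)$ is the minimum of $|A|$ over all $A\subseteq\mathbb Z/p\mathbb Z$ with $|A|\ge 2$ having no unique sum (this minimum exists). -}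

module Defs where

open import Algebra.Bundles using (AbelianGroup; CommutativeRing)
import Algebra.Properties.CommutativeSemiring.Exp as Exp
open import Data.Empty using (⊥; ⊥-elim)
open import Data.Fin.Base using (Fin; toℕ)
import Data.Fin.Properties as FinP
open import Data.Fin.Properties using (toℕ-fromℕ<; toℕ<n; toℕ-injective; all?; any?)
open import Data.Fin.Subset using (Subset; _∈_; ⊤; ∣_∣)
open import Data.Fin.Subset.Properties using (_∈?_; ∈⊤; ∣⊤∣≡n; anySubset?)
open import Data.Integer.Base as ℤ using (-[1+_])
import Data.Integer.Properties as ℤ
open import Data.Nat.Base as ℕ using (ℕ; zero; suc)
open import Data.Nat.DivMod using (_%_; _mod_; m%n<n; m<n⇒m%n≡m; m%n%n≡m%n; %-distribˡ-+; n%n≡0)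
open import Data.Nat.Induction using (<-wellFounded)
open import Data.Nat.Primality using (Prime; prime⇒nonZero; prime⇒nonTrivial)
import Data.Nat.Properties as ℕ
open import Data.Product using (∃; ∃₂; _×_; _,_; proj₁; proj₂)
open import Data.Rational.Base hiding (∣_∣)
open import Data.Rational.Properties
open import Data.Rational.Solver using (module +-*-Solver)
open import Data.Rational.Unnormalised.Base as ℚᵘ using (mkℚᵘ; *≡*)
import Data.Rational.Unnormalised.Properties as ℚᵘ
open import Data.Sum using (_⊎_; inj₁; inj₂)
open import Induction.WellFounded using (Acc; acc)
open import Level using () renaming (_⊔_ to _⊔ˡ_)
open import Relation.Binary.PropositionalEquality
open import Relation.Nullary using (¬_; Dec; yes; no)
open import Relation.Nullary.Decidable using (_×-dec_; _⊎-dec_; _→-dec_; ¬?)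
open import Relation.Unary using (Pred)

open +-*-Solver using (solve; _:+_; _:*_; _:-_; :-_; _:=_; con)
open Exp (CommutativeRing.commutativeSemiring +-*-commutativeRing) using (_^_; ^-distrib-*; ^-assocʳ)

lt : ∀ {p q} → 0ℚ < q - p → p < q
lt {p} {q} h = subst₂ _<_ (+-identityˡ p) (solve 2 (λ p q → q :- p :+ p := q) refl p q) (+-monoˡ-< p h)

sub : ∀ {p q} → p < q → 0ℚ < q - p
sub {p} {q} h = subst₂ _<_ (+-inverseʳ p) refl (+-monoˡ-< (- p) h)

le : ∀ {p q} → 0ℚ ≤ q - p → p ≤ q
le {p} {q} h = subst₂ _≤_ (+-identityˡ p) (solve 2 (λ p q → q :- p :+ p := q) refl p q) (+-monoˡ-≤ p h)

sub≤ : ∀ {p q} → p ≤ q → 0ℚ ≤ q - p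
sub≤ {p} {q} h = subst₂ _≤_ (+-inverseʳ p) refl (+-monoˡ-≤ (- p) h)

pos* : ∀ {p q} → 0ℚ < p → 0ℚ < q → 0ℚ < p * q
pos* {p} {q} hp hq = positive⁻¹ (p * q) {{pos*pos⇒pos p {{positive hp}} q {{positive hq}}}}

nn* : ∀ {p q} → 0ℚ ≤ p → 0ℚ ≤ q → 0ℚ ≤ p * q
nn* {p} {q} hp hq = nonNegative⁻¹ (p * q) {{nonNeg*nonNeg⇒nonNeg p {{nonNegative hp}} q {{nonNegative hq}}}}

pos+ : ∀ {p q} → 0ℚ < p → 0ℚ ≤ q → 0ℚ < p + q
pos+ hp hq = +-mono-<-≤ hp hq

nn+ : ∀ {p q} → 0ℚ ≤ p → 0ℚ ≤ q → 0ℚ ≤ p + q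
nn+ hp hq = +-mono-≤ hp hq

*<ʳ : ∀ {c a b} → 0ℚ < c → a < b → a * c < b * c
*<ʳ {c} hc = *-monoˡ-<-pos c {{positive hc}}

*≤ʳ : ∀ {c a b} → 0ℚ ≤ c → a ≤ b → a * c ≤ b * c
*≤ʳ {c} hc = *-monoʳ-≤-nonNeg c {{nonNegative hc}}

*≤ˡ : ∀ {c a b} → 0ℚ ≤ c → a ≤ b → c * a ≤ c * b
*≤ˡ {c} hc = *-monoˡ-≤-nonNeg c {{nonNegative hc}}

cancel<ʳ : ∀ {c a b} → 0ℚ < c → a * c < b * c → a < b
cancel<ʳ {c} hc = *-cancelʳ-<-nonNeg c {{nonNegative (<⇒≤ hc)}}

0<1 : 0ℚ < 1ℚ
0<1 = positive⁻¹ 1ℚ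

inverse : ∀ {c} → 0ℚ < c → ∃ λ i → 0ℚ < i × i * c ≡ 1ℚ
inverse {c} hc = 1/ c , positive⁻¹ _ {{1/pos⇒pos c}} , *-inverseˡ c
  where instance
    _ = positive hc
    _ = pos⇒nonZero c

shrink : ∀ {t r c} → 0ℚ < c → t < r * c → ∃ λ r′ → r′ < r × t < r′ * c
shrink {t} {r} {c} hc h with <-dense h | inverse hc
... | y , t<y , y<rc | i , _ , ic =
  y * i , cancel<ʳ hc (subst (_< r * c) (sym eq) y<rc) , subst (t <_) (sym eq) t<y
  where
  eq : y * i * c ≡ y
  eq = trans (*-assoc y i c) (trans (cong (y *_) ic) (*-identityʳ y))

ι : ℕ → ℚ
ι n = ℤ.+ n / 1

inv : ℕ → ℚ
inv n = ℤ.+ 1 / suc n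

ι-+ : ∀ m n → ι (m ℕ.+ n) ≡ ι m + ι n
ι-+ m n = toℚᵘ-injective (begin
  toℚᵘ (ι (m ℕ.+ n))           ≈⟨ toℚᵘ-fromℚᵘ (mkℚᵘ (ℤ.+ (m ℕ.+ n)) 0) ⟩
  mkℚᵘ (ℤ.+ (m ℕ.+ n)) 0         ≈⟨ *≡* (cong (ℤ._* ℤ.+ 1) (cong₂ ℤ._+_ (sym (ℤ.*-identityʳ (ℤ.+ m))) (sym (ℤ.*-identityʳ (ℤ.+ n))))) ⟩
  mkℚᵘ (ℤ.+ m) 0 ℚᵘ.+ mkℚᵘ (ℤ.+ n) 0 ≈⟨ ℚᵘ.+-cong (ℚᵘ.≃-sym (toℚᵘ-fromℚᵘ (mkℚᵘ (ℤ.+ m) 0))) (ℚᵘ.≃-sym (toℚᵘ-fromℚᵘ (mkℚᵘ (ℤ.+ n) 0))) ⟩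
  toℚᵘ (ι m) ℚᵘ.+ toℚᵘ (ι n)     ≈⟨ ℚᵘ.≃-sym (toℚᵘ-homo-+ (ι m) (ι n)) ⟩
  toℚᵘ (ι m + ι n) ∎)
  where open ℚᵘ.≃-Reasoning

ι-suc : ∀ n → ι (suc n) ≡ 1ℚ + ι n
ι-suc = ι-+ 1

ι-* : ∀ m n → ι (m ℕ.* n) ≡ ι m * ι n
ι-* zero n = sym (*-zeroˡ (ι n))
ι-* (suc m) n = begin
  ι (n ℕ.+ m ℕ.* n)   ≡⟨ ι-+ n (m ℕ.* n) ⟩
  ι n + ι (m ℕ.* n)   ≡⟨ cong (ι n +_) (ι-* m n) ⟩
  ι n + ι m * ι n     ≡⟨ solve 2 (λ x y → x :+ y :* x := (con 1ℚ :+ y) :* x) refl (ι n) (ι m) ⟩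
  (1ℚ + ι m) * ι n    ≡⟨ cong (_* ι n) (sym (ι-suc m)) ⟩
  ι (suc m) * ι n     ∎
  where open ≡-Reasoning

ι-inv : ∀ n → ι (suc n) * inv n ≡ 1ℚ
ι-inv n = toℚᵘ-injective (begin
  toℚᵘ (ι (suc n) * inv n)             ≈⟨ toℚᵘ-homo-* (ι (suc n)) (inv n) ⟩
  toℚᵘ (ι (suc n)) ℚᵘ.* toℚᵘ (inv n)   ≈⟨ ℚᵘ.*-cong (toℚᵘ-fromℚᵘ (mkℚᵘ (ℤ.+ suc n) 0)) (toℚᵘ-fromℚᵘ (mkℚᵘ (ℤ.+ 1) n)) ⟩
  mkℚᵘ (ℤ.+ suc n) 0 ℚᵘ.* mkℚᵘ (ℤ.+ 1) n   ≈⟨ *≡* (trans (trans (ℤ.*-identityʳ _) (ℤ.*-identityʳ (ℤ.+ suc n))) (sym (trans (ℤ.*-identityˡ _) (cong (λ k → ℤ.+ suc k) (ℕ.+-identityʳ n))))) ⟩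
  mkℚᵘ (ℤ.+ 1) 0                         ∎)
  where open ℚᵘ.≃-Reasoning

inv>0 : ∀ n → 0ℚ < inv n
inv>0 n = positive⁻¹ (inv n) {{normalize-pos 1 (suc n)}}

ι≥0 : ∀ n → 0ℚ ≤ ι n
ι≥0 n = nonNegative⁻¹ (ι n) {{normalize-nonNeg n 1}}

ι>0 : ∀ n → 0ℚ < ι (suc n)
ι>0 n = subst (0ℚ <_) (sym (ι-suc n)) (pos+ 0<1 (ι≥0 n))

ι-mono : ∀ {m n} → m ℕ.≤ n → ι m ≤ ι n
ι-mono {m} {n} h with ℕ.m≤n⇒∃[o]m+o≡n h
... | o , refl = le (subst (0ℚ ≤_) (trans (solve 2 (λ x y → y := x :+ y :- x) refl (ι m) (ι o)) (cong (_- ι m) (sym (ι-+ m o)))) (ι≥0 o))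

arch : ∀ x → ∃ λ n → x < ι (suc n)
arch x@(mkℚ (ℤ.+ k) d _) = k , toℚᵘ-cancel-< (ℚᵘ.<-respʳ-≃ (ℚᵘ.≃-sym (toℚᵘ-fromℚᵘ (mkℚᵘ (ℤ.+ suc k) 0)))
  (ℚᵘ.*<* (ℤ.<-≤-trans (subst (ℤ._< ℤ.+ suc k) (sym (ℤ.*-identityʳ (ℤ.+ k))) (ℤ.+<+ (ℕ.n<1+n k)))
     (ℤ.+≤+ (ℕ.m≤m*n (suc k) (suc d))))))
arch x@(mkℚ -[1+ k ] d _) = 0 , <-trans (negative⁻¹ x) 0<1

p≤max₁ : ∀ x y z → x ≤ x ⊔ (y ⊔ z)
p≤max₁ x y z = p≤p⊔q x (y ⊔ z)
p≤max₂ : ∀ x y z → y ≤ x ⊔ (y ⊔ z)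
p≤max₂ x y z = ≤-trans (p≤p⊔q y z) (p≤q⊔p x (y ⊔ z))
p≤max₃ : ∀ x y z → z ≤ x ⊔ (y ⊔ z)
p≤max₃ x y z = ≤-trans (p≤q⊔p y z) (p≤q⊔p x (y ⊔ z))

pow>0 : ∀ {x} n → 0ℚ < x → 0ℚ < x ^ n
pow>0 zero h = 0<1
pow>0 (suc n) h = pos* h (pow>0 n h)

pow≥0 : ∀ {x} n → 0ℚ ≤ x → 0ℚ ≤ x ^ n
pow≥0 zero h = <⇒≤ 0<1
pow≥0 (suc n) h = nn* h (pow≥0 n h)

pow-mono : ∀ {x y} n → 0ℚ ≤ x → x ≤ y → x ^ n ≤ y ^ n
pow-mono zero h g = ≤-refl
pow-mono (suc n) h g = ≤-trans (*≤ʳ (pow≥0 n h) g) (*≤ˡ (≤-trans h g) (pow-mono n h g))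

1^ : ∀ n → 1ℚ ^ n ≡ 1ℚ
1^ zero = refl
1^ (suc n) = trans (*-identityˡ _) (1^ n)

pow≤1 : ∀ {x} n → 0ℚ ≤ x → x ≤ 1ℚ → x ^ n ≤ 1ℚ
pow≤1 {x} n h g = subst (x ^ n ≤_) (1^ n) (pow-mono n h g)

pow≥1 : ∀ {x} n → 1ℚ ≤ x → 1ℚ ≤ x ^ n
pow≥1 {x} n h = subst (_≤ x ^ n) (1^ n) (pow-mono n (<⇒≤ 0<1) h)

pow>1 : ∀ {x} n → 1ℚ < x → 1ℚ < x ^ suc n
pow>1 {x} n h = <-≤-trans h (subst (_≤ x * x ^ n) (*-identityʳ x) (*≤ˡ (<⇒≤ (<-trans 0<1 h)) (pow≥1 n (<⇒≤ h))))

bernoulli : ∀ {y} n → 0ℚ ≤ 1ℚ + y → 0ℚ ≤ y * y → 1ℚ + ι n * y ≤ (1ℚ + y) ^ n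
bernoulli {y} zero h _ = ≤-reflexive (solve 1 (λ y → con 1ℚ :+ con 0ℚ :* y := con 1ℚ) refl y)
bernoulli {y} (suc n) h y² = ≤-trans
  (le (subst (0ℚ ≤_)
    (trans (solve 2 (λ y k → k :* (y :* y) := (con 1ℚ :+ y) :* (con 1ℚ :+ k :* y) :- (con 1ℚ :+ (con 1ℚ :+ k) :* y)) refl y (ι n))
           (cong (λ k → (1ℚ + y) * (1ℚ + ι n * y) - (1ℚ + k * y)) (sym (ι-suc n))))
    (nn* (ι≥0 n) y²)))
  (*≤ˡ h (bernoulli n h y²))

sq≥0 : ∀ y → 0ℚ ≤ y * y
sq≥0 y with ≤-total 0ℚ y
... | inj₁ h = nn* h h
... | inj₂ h = subst (0ℚ ≤_) (solve 1 (λ y → (:- y) :* (:- y) := y :* y) refl y) (nn* (neg-antimono-≤ h) (neg-antimono-≤ h))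

max< : ∀ {p q r} → p < r → q < r → ∃ λ m → p ≤ m × q ≤ m × m < r
max< {p} {q} {r} h g = pick (≤-total p q)
  where
  pick : p ≤ q ⊎ q ≤ p → ∃ λ m → p ≤ m × q ≤ m × m < r
  pick (inj₁ e) = q , e , ≤-refl , g
  pick (inj₂ e) = p , ≤-refl , e , h

shrink^ : ∀ {t r s} n → 0ℚ < r → 0ℚ < s → t < r * s ^ n → ∃ λ s′ → s′ < s × 0ℚ < s′ × t < r * s′ ^ n
shrink^ zero hr hs h = let s′ , a , b = <-dense hs in s′ , b , a , h
shrink^ {t} {r} {s} (suc n) hr hs h =
  let s₁ , s₁<s , 0<s₁ , h₁ = shrink^ {t} {r * s} {s} n (pos* hr hs) hs
                                (subst (t <_) (sym (*-assoc r s (s ^ n))) h)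
      c>0 = pos* hr (pow>0 n 0<s₁)
      s₂ , s₂<s , h₂ = shrink {t} {s} {r * s₁ ^ n} c>0 (subst (t <_) (swap r s (s₁ ^ n)) h₁)
      s₃ , a , b , s₃<s = max< s₁<s s₂<s
      0<s₃ = <-≤-trans 0<s₁ a
  in s₃ , s₃<s , 0<s₃ , <-≤-trans h₂ (bound s₁ s₂ s₃ 0<s₁ 0<s₃ a b)
  where
  swap : ∀ r s x → r * s * x ≡ s * (r * x)
  swap = solve 3 (λ r s x → r :* s :* x := s :* (r :* x)) refl
  bound : ∀ x y z → 0ℚ < x → 0ℚ < z → x ≤ z → y ≤ z → y * (r * x ^ n) ≤ r * (z * z ^ n)
  bound x y z 0<x 0<z x≤z y≤z = ≤-trans
    (*≤ʳ (<⇒≤ (pos* hr (pow>0 n 0<x))) y≤z)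
    (≤-trans (*≤ˡ (<⇒≤ 0<z) (*≤ˡ (<⇒≤ hr) (pow-mono n (<⇒≤ 0<x) x≤z)))
      (≤-reflexive (trans (sym (swap r z (z ^ n))) (*-assoc r z (z ^ n)))))

-- Constructive Dedekind reals: lower q means q < x and upper r means x < r.
-- Equality of reals is never needed; it would be mutual ≤ℝ.
record ℝ : Set₁ where
  field
    lower upper     : ℚ → Set
    lower-inhabited : ∃ lower
    upper-inhabited : ∃ upper
    lower-closed    : ∀ {q r} → q < r → lower r → lower q
    upper-closed    : ∀ {q r} → q < r → upper q → upper r
    lower-open      : ∀ {q} → lower q → ∃ λ r → q < r × lower r
    upper-open      : ∀ {r} → upper r → ∃ λ q → q < r × upper q
    disjoint        : ∀ {q} → lower q → upper q → ⊥
    located         : ∀ {q r} → q < r → lower q ⊎ upper r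

open ℝ

infix 4 _<ℝ_ _≤ℝ_

_<ℝ_ : ℝ → ℝ → Set
x <ℝ y = ∃ λ q → upper x q × lower y q

_≤ℝ_ : ℝ → ℝ → Set
x ≤ℝ y = ∀ q → lower x q → lower y q

fromℚ : ℚ → ℝ
fromℚ x .lower q = q < x
fromℚ x .upper q = x < q
fromℚ x .lower-inhabited = x - 1ℚ , lt (subst (0ℚ <_) (solve 1 (λ x → con 1ℚ := x :- (x :- con 1ℚ)) refl x) 0<1)
fromℚ x .upper-inhabited = x + 1ℚ , lt (subst (0ℚ <_) (solve 1 (λ x → con 1ℚ := (x :+ con 1ℚ) :- x) refl x) 0<1)
fromℚ x .lower-closed = <-trans
fromℚ x .upper-closed h g = <-trans g h
fromℚ x .lower-open h = let r , a , b = <-dense h in r , a , b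
fromℚ x .upper-open h = let r , a , b = <-dense h in r , b , a
fromℚ x .disjoint = <-asym
fromℚ x .located {q} {r} q<r with q <? x
... | yes h = inj₁ h
... | no h = inj₂ (≤-<-trans (≮⇒≥ h) q<r)

fromℕ : ℕ → ℝ
fromℕ n = fromℚ (ι n)

0ℝ 1ℝ : ℝ
0ℝ = fromℕ 0
1ℝ = fromℕ 1

lower<upper : ∀ x {q r} → lower x q → upper x r → q < r
lower<upper x {q} {r} hq hr with q <? r
... | yes h = h
... | no h with r ≟ q
...   | yes refl = ⊥-elim (disjoint x hq hr)
...   | no r≢q = ⊥-elim (disjoint x hq (upper-closed x (≤∧≢⇒< (≮⇒≥ h) r≢q) hr))
  where
  ≤∧≢⇒< : ∀ {p q} → p ≤ q → ¬ (p ≡ q) → p < q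
  ≤∧≢⇒< {p} {q} h ne with p <? q
  ... | yes l = l
  ... | no l = ⊥-elim (ne (≤-antisym h (≮⇒≥ l)))

<ℝ-asym : ∀ x y → x <ℝ y → y <ℝ x → ⊥
<ℝ-asym x y (q , a , b) (r , c , d) = <-asym (lower<upper x d a) (lower<upper y b c)

approx : ∀ x h → 0ℚ < h → ∃ λ a → lower x a × upper x (a + h)
approx x h 0<h =
  let k , k<h , 0<k , 2k≤h = half
      a , la = lower-inhabited x
      b , ub = upper-inhabited x
      i , 0<i , ik≡1 = inverse 0<k
      n , n> = arch ((b - a) * i)
      b<a+nk = lt (subst (0ℚ <_) (solve 4 (λ n k a b → n :* k :- (b :- a) := a :+ n :* k :- b) refl (ι (suc n)) k a b)
                 (sub (subst (_< ι (suc n) * k) (trans (*-assoc (b - a) i k) (trans (cong ((b - a) *_) ik≡1) (*-identityʳ (b - a)))) (*<ʳ 0<k n>))))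
  in walk k 0<k 2k≤h (suc n) a la (upper-closed x b<a+nk ub)
  where
  half : ∃ λ k → k < h × 0ℚ < k × k + k ≤ h
  half = let i , 0<i , i2 = inverse {1ℚ + 1ℚ} (pos+ 0<1 (<⇒≤ 0<1))
             eq = trans (solve 2 (λ h i → h :* i :+ h :* i := h :* (i :* (con 1ℚ :+ con 1ℚ))) refl h i) (trans (cong (h *_) i2) (*-identityʳ h))
             0<k = pos* 0<h 0<i
         in h * i , subst (h * i <_) eq (lt (subst (0ℚ <_) (solve 1 (λ k → k := k :+ k :- k) refl (h * i)) 0<k)) , 0<k , ≤-reflexive eq
  walk : ∀ k → 0ℚ < k → k + k ≤ h → ∀ n a → lower x a → upper x (a + ι n * k) → ∃ λ a → lower x a × upper x (a + h)
  walk k 0<k 2k≤h zero a la ua = ⊥-elim (disjoint x la (subst (upper x) (solve 2 (λ a k → a :+ con 0ℚ :* k := a) refl a k) ua))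
  walk k 0<k 2k≤h (suc n) a la ua = step (located x a+k<a+h′)
    where
    a+k<a+h′ : a + k < a + k + k
    a+k<a+h′ = lt (subst (0ℚ <_) (solve 2 (λ a k → k := a :+ k :+ k :- (a :+ k)) refl a k) 0<k)
    widen : a + k + k ≤ a + h
    widen = subst (_≤ a + h) (sym (+-assoc a k k)) (+-monoʳ-≤ a 2k≤h)
    step : lower x (a + k) ⊎ upper x (a + k + k) → ∃ λ a → lower x a × upper x (a + h)
    step (inj₁ l) = walk k 0<k 2k≤h n (a + k) l (subst (upper x)
      (trans (cong (λ j → a + j * k) (ι-suc n)) (solve 3 (λ a n k → a :+ (con 1ℚ :+ n) :* k := a :+ k :+ n :* k) refl a (ι n) k)) ua)
    step (inj₂ u) = a , la , weaken (a + k + k ≟ a + h)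
      where
      weaken : Dec (a + k + k ≡ a + h) → upper x (a + h)
      weaken (yes e) = subst (upper x) e u
      weaken (no ne) = upper-closed x (≰⇒> (λ g → ne (≤-antisym widen g))) u

-- A rational rectangle (a , b) × (c , d) containing (x , y).  On it the
-- product is bounded by its extreme corner values, and as the rectangle
-- shrinks these bounds close in on x y (see *-located).
record Enclosure (x y : ℝ) : Set where
  field
    {a b c d} : ℚ
    a<x : lower x a
    x<b : upper x b
    c<y : lower y c
    y<d : upper y d
  minCorner maxCorner : ℚ
  minCorner = ((a * c) ⊓ (a * d)) ⊓ ((b * c) ⊓ (b * d))
  maxCorner = ((a * c) ⊔ (a * d)) ⊔ ((b * c) ⊔ (b * d))

open Enclosure

between : ∀ {u a b} t → a ≤ u → u ≤ b → (a * t) ⊓ (b * t) ≤ u * t × u * t ≤ (a * t) ⊔ (b * t)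
between {u} {a} {b} t h g with ≤-total 0ℚ t
... | inj₁ s = ≤-trans (p⊓q≤p (a * t) (b * t)) (*≤ʳ s h) , ≤-trans (*≤ʳ s g) (p≤q⊔p (a * t) (b * t))
... | inj₂ s = ≤-trans (p⊓q≤q (a * t) (b * t)) (*-monoʳ-≤-nonPos t {{nonPositive s}} g) ,
               ≤-trans (*-monoʳ-≤-nonPos t {{nonPositive s}} h) (p≤p⊔q (a * t) (b * t))

corners : ∀ {x y} (B : Enclosure x y) {u v} → a B ≤ u → u ≤ b B → c B ≤ v → v ≤ d B →
          minCorner B ≤ u * v × u * v ≤ maxCorner B
corners B {u} {v} au ub cv vd =
  let l , r = between v au ub
      la , ra = swapped (a B)
      lb , rb = swapped (b B)
  in ≤-trans (⊓-mono-≤ la lb) l , ≤-trans r (⊔-mono-≤ ra rb)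
  where
  swapped : ∀ s → (s * c B) ⊓ (s * d B) ≤ s * v × s * v ≤ (s * c B) ⊔ (s * d B)
  swapped s = let l , r = between s cv vd in
    subst₂ _≤_ (cong₂ _⊓_ (*-comm (c B) s) (*-comm (d B) s)) (*-comm v s) l ,
    subst₂ _≤_ (*-comm v s) (cong₂ _⊔_ (*-comm (c B) s) (*-comm (d B) s)) r

meet : ∀ x {a b a′ b′} → lower x a → upper x b → lower x a′ → upper x b′ →
       ∃ λ u → (a ≤ u × u ≤ b) × (a′ ≤ u × u ≤ b′)
meet x {a} {b} {a′} {b′} la ub la′ ub′ with ≤-total a a′
... | inj₁ h = a′ , (h , <⇒≤ (lower<upper x la′ ub)) , (≤-refl , <⇒≤ (lower<upper x la′ ub′))
... | inj₂ h = a , (≤-refl , <⇒≤ (lower<upper x la ub)) , (h , <⇒≤ (lower<upper x la ub′))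

min≤max : ∀ {x y} (B B′ : Enclosure x y) → minCorner B ≤ maxCorner B′
min≤max {x} {y} B B′ =
  let u , (p , q) , (p′ , q′) = meet x (a<x B) (x<b B) (a<x B′) (x<b B′)
      v , (r , s) , (r′ , s′) = meet y (c<y B) (y<d B) (c<y B′) (y<d B′)
  in ≤-trans (proj₁ (corners B p q r s)) (proj₂ (corners B′ p′ q′ r′ s′))

enclosure : ∀ x y → Enclosure x y
enclosure x y = record
  { a<x = proj₂ (lower-inhabited x) ; x<b = proj₂ (upper-inhabited x)
  ; c<y = proj₂ (lower-inhabited y) ; y<d = proj₂ (upper-inhabited y) }

*-located : ∀ x y {q r} → q < r →
            (∃ λ (B : Enclosure x y) → q < minCorner B) ⊎ (∃ λ (B : Enclosure x y) → maxCorner B < r)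
*-located x y {q} {r} q<r = decide (q <? minCorner box)
  where
  B₀ = enclosure x y
  K L M : ℚ
  K = (1ℚ - a B₀) ⊔ (b B₀ ⊔ 0ℚ)
  L = (1ℚ - c B₀) ⊔ (d B₀ ⊔ 0ℚ)
  M = K + L + 1ℚ
  0≤K : 0ℚ ≤ K
  0≤K = p≤max₃ (1ℚ - a B₀) (b B₀) 0ℚ
  0≤L : 0ℚ ≤ L
  0≤L = p≤max₃ (1ℚ - c B₀) (d B₀) 0ℚ
  0<M : 0ℚ < M
  0<M = subst (0ℚ <_) (+-comm 1ℚ (K + L)) (pos+ 0<1 (nn+ 0≤K 0≤L))
  small : ∃ λ δ → 0ℚ < δ × δ ≤ 1ℚ × M * δ + M * δ < r - q
  small =
    let e , 0<e , e<ε = <-dense (sub q<r)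
        i , 0<i , iM = inverse (pos+ 0<M (<⇒≤ 0<M))
        eq : (M + M) * (e * i) ≡ e
        eq = trans (solve 3 (λ m e i → m :* (e :* i) := e :* (i :* m)) refl (M + M) e i) (trans (cong (e *_) iM) (*-identityʳ e))
        bound : ∀ {δ} → δ ≤ e * i → M * δ + M * δ < r - q
        bound {δ} h = ≤-<-trans (subst₂ _≤_ (*-distribʳ-+ δ M M) eq (*≤ˡ (<⇒≤ (pos+ 0<M (<⇒≤ 0<M))) h)) e<ε
        pick : e * i ≤ 1ℚ ⊎ 1ℚ ≤ e * i → ∃ λ δ → 0ℚ < δ × δ ≤ 1ℚ × M * δ + M * δ < r - q
        pick = λ { (inj₁ h) → e * i , pos* 0<e 0<i , h , bound ≤-refl
                 ; (inj₂ h) → 1ℚ , 0<1 , ≤-refl , bound h }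
    in pick (≤-total (e * i) 1ℚ)
  δ = proj₁ small
  0<δ : 0ℚ < δ
  0<δ = proj₁ (proj₂ small)
  δ≤1 : δ ≤ 1ℚ
  δ≤1 = proj₁ (proj₂ (proj₂ small))
  near-x = approx x δ 0<δ
  near-y = approx y δ 0<δ
  α = proj₁ near-x
  γ = proj₁ near-y
  box : Enclosure x y
  box = record { a<x = proj₁ (proj₂ near-x) ; x<b = proj₂ (proj₂ near-x)
               ; c<y = proj₁ (proj₂ near-y) ; y<d = proj₂ (proj₂ near-y) }
  range : ∀ z {l u t} → lower z l → upper z u → lower z t → upper z (t + δ) →
          (- ((1ℚ - l) ⊔ (u ⊔ 0ℚ)) ≤ t) × (t ≤ (1ℚ - l) ⊔ (u ⊔ 0ℚ))
  range z {l} {u} {t} zl zu zt zt+ =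
    ≤-trans (neg-antimono-≤ (p≤max₁ (1ℚ - l) u 0ℚ))
      (le (subst (0ℚ ≤_) (solve 3 (λ t δ l → (t :+ δ :- l) :+ (con 1ℚ :- δ) := t :- (:- (con 1ℚ :- l))) refl t δ l)
            (nn+ (sub≤ (<⇒≤ (lower<upper z zl zt+))) (sub≤ δ≤1)))) ,
    ≤-trans (<⇒≤ (lower<upper z zt zu)) (p≤max₂ (1ℚ - l) u 0ℚ)
  range-x = range x (a<x B₀) (x<b B₀) (proj₁ (proj₂ near-x)) (proj₂ (proj₂ near-x))
  range-y = range y (c<y B₀) (y<d B₀) (proj₁ (proj₂ near-y)) (proj₂ (proj₂ near-y))
  Near : ℚ → Set
  Near z = (α * γ ≤ z + M * δ) × (z ≤ α * γ + M * δ)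
  scaled : ∀ {s z} → - M ≤ s → s ≤ M → z ≡ α * γ + s * δ → Near z
  scaled {s} h g refl =
    le (subst (0ℚ ≤_) (solve 4 (λ p s m d → (s :- (:- m)) :* d := p :+ s :* d :+ m :* d :- p) refl (α * γ) s M δ)
         (nn* (sub≤ h) (<⇒≤ 0<δ))) ,
    +-monoʳ-≤ (α * γ) (*≤ʳ (<⇒≤ 0<δ) g)
  weaken : ∀ {s u v} → 0ℚ ≤ u → s ≤ v → s ≤ v + u
  weaken {s} {u} {v} hu h = subst (_≤ v + u) (+-identityʳ s) (+-mono-≤ h hu)
  flip-neg : ∀ {s v} → - s ≤ v → - v ≤ s
  flip-neg {s} {v} h = subst (- v ≤_) (solve 1 (λ s → :- (:- s) := s) refl s) (neg-antimono-≤ h)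
  unflip : ∀ {s} → - s ≤ M → - M ≤ s
  unflip = flip-neg
  K≤M : ∀ {s} → s ≤ K → s ≤ M
  K≤M h = weaken (<⇒≤ 0<1) (weaken 0≤L h)
  L≤M : ∀ {s} → s ≤ L → s ≤ M
  L≤M {s} h = weaken (<⇒≤ 0<1) (subst (s ≤_) (+-comm L K) (weaken 0≤K h))
  nearest : Near (α * γ)
  nearest = scaled (unflip {0ℚ} (<⇒≤ 0<M)) (<⇒≤ 0<M) (solve 2 (λ p d → p := p :+ con 0ℚ :* d) refl (α * γ) δ)
  near-d : Near (α * (γ + δ))
  near-d = scaled (unflip (K≤M (flip-neg (proj₁ range-x)))) (K≤M (proj₂ range-x)) (*-distribˡ-+ α γ δ)
  near-b : Near ((α + δ) * γ)
  near-b = scaled (unflip (L≤M (flip-neg (proj₁ range-y)))) (L≤M (proj₂ range-y))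
    (solve 3 (λ a c d → (a :+ d) :* c := a :* c :+ c :* d) refl α γ δ)
  near-bd : Near ((α + δ) * (γ + δ))
  near-bd = scaled
    (unflip (subst (_≤ M) (solve 3 (λ a c d → (:- a :+ :- c) :+ :- d := :- (a :+ c :+ d)) refl α γ δ)
      (+-mono-≤ (+-mono-≤ (flip-neg (proj₁ range-x)) (flip-neg (proj₁ range-y)))
                (≤-trans (neg-antimono-≤ (<⇒≤ 0<δ)) (<⇒≤ 0<1)))))
    (+-mono-≤ (+-mono-≤ (proj₂ range-x) (proj₂ range-y)) δ≤1)
    (solve 3 (λ a c d → (a :+ d) :* (c :+ d) := a :* c :+ (a :+ c :+ d) :* d) refl α γ δ)
  below : ∀ {z} → Near z → α * γ - M * δ ≤ z
  below {z} (h , _) = le (subst (0ℚ ≤_) (solve 3 (λ p z e → z :+ e :- p := z :- (p :- e)) refl (α * γ) z (M * δ)) (sub≤ h))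
  min≥ : α * γ - M * δ ≤ minCorner box
  min≥ = ⊓-glb (⊓-glb (below nearest) (below near-d)) (⊓-glb (below near-b) (below near-bd))
  max≤ : maxCorner box ≤ α * γ + M * δ
  max≤ = ⊔-lub (⊔-lub (proj₂ nearest) (proj₂ near-d)) (⊔-lub (proj₂ near-b) (proj₂ near-bd))
  final : ∀ {mn mx} → α * γ - M * δ ≤ mn → mx ≤ α * γ + M * δ → mn ≤ q → mx < r
  final {mn} {mx} h g l = ≤-<-trans g (lt (subst (0ℚ <_)
    (solve 5 (λ p e q r m → (r :- q :- (e :+ e)) :+ ((q :- m) :+ (m :- (p :- e))) := r :- (p :+ e)) refl (α * γ) (M * δ) q r mn)
    (pos+ (sub (proj₂ (proj₂ (proj₂ small)))) (nn+ (sub≤ l) (sub≤ h)))))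
  decide : Dec (q < minCorner box) → (∃ λ (B : Enclosure x y) → q < minCorner B) ⊎ (∃ λ (B : Enclosure x y) → maxCorner B < r)
  decide (yes h) = inj₁ (box , h)
  decide (no h) = inj₂ (box , final min≥ max≤ (≮⇒≥ h))

infixl 7 _*ℝ_

_*ℝ_ : ℝ → ℝ → ℝ
(x *ℝ y) .lower q = ∃ λ (B : Enclosure x y) → q < minCorner B
(x *ℝ y) .upper r = ∃ λ (B : Enclosure x y) → maxCorner B < r
(x *ℝ y) .lower-inhabited = let B = enclosure x y ; q , h = lower-inhabited (fromℚ (minCorner B)) in q , B , h
(x *ℝ y) .upper-inhabited = let B = enclosure x y ; q , h = upper-inhabited (fromℚ (maxCorner B)) in q , B , h
(x *ℝ y) .lower-closed h (B , g) = B , <-trans h g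
(x *ℝ y) .upper-closed h (B , g) = B , <-trans g h
(x *ℝ y) .lower-open (B , g) = let r , a , b = <-dense g in r , a , B , b
(x *ℝ y) .upper-open (B , g) = let r , a , b = <-dense g in r , b , B , a
(x *ℝ y) .disjoint (B , h) (B′ , g) = <-irrefl refl (<-trans (≤-<-trans (min≤max B B′) g) h)
(x *ℝ y) .located = *-located x y

step : ℚ → ℕ → ℚ
step q n = 1ℚ + q * inv n

compound : ℚ → ℕ → ℚ
compound q n = step q n ^ suc n

step>0 : ∀ q n → - q < ι (suc n) → 0ℚ < step q n
step>0 q n h = subst (0ℚ <_)
  (trans (solve 3 (λ k q i → (k :- (:- q)) :* i := k :* i :+ q :* i) refl (ι (suc n)) q (inv n)) (cong (_+ q * inv n) (ι-inv n)))
  (pos* (sub h) (inv>0 n))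

inv≤1 : ∀ n → inv n ≤ 1ℚ
inv≤1 n = subst (inv n ≤_) (ι-inv n) (subst (_≤ ι (suc n) * inv n) (*-identityˡ (inv n))
  (*≤ʳ {inv n} {1ℚ} {ι (suc n)} (<⇒≤ (inv>0 n)) (ι-mono {1} {suc n} (ℕ.s≤s ℕ.z≤n))))

inv-* : ∀ m n → inv m ≡ ι (suc n) * inv (n ℕ.+ m ℕ.* suc n)
inv-* m n = begin
  inv m                                              ≡⟨ sym (*-identityʳ (inv m)) ⟩
  inv m * 1ℚ                                         ≡⟨ cong (inv m *_) (sym (ι-inv (n ℕ.+ m ℕ.* suc n))) ⟩
  inv m * (ι (suc m ℕ.* suc n) * i)                  ≡⟨ cong (λ z → inv m * (z * i)) (ι-* (suc m) (suc n)) ⟩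
  inv m * (ι (suc m) * ι (suc n) * i)                ≡⟨ solve 4 (λ a b c d → a :* (b :* c :* d) := b :* a :* (c :* d)) refl (inv m) (ι (suc m)) (ι (suc n)) i ⟩
  ι (suc m) * inv m * (ι (suc n) * i)                ≡⟨ cong (_* (ι (suc n) * i)) (ι-inv m) ⟩
  1ℚ * (ι (suc n) * i)                               ≡⟨ *-identityˡ _ ⟩
  ι (suc n) * i                                      ∎
  where
  open ≡-Reasoning
  i = inv (n ℕ.+ m ℕ.* suc n)

inv-*′ : ∀ m n → inv (n ℕ.+ m ℕ.* suc n) ≡ inv m * inv n
inv-*′ m n = sym (begin
  inv m * inv n            ≡⟨ cong (_* inv n) (inv-* m n) ⟩
  ι (suc n) * i * inv n    ≡⟨ solve 3 (λ a b c → a :* b :* c := b :* (a :* c)) refl (ι (suc n)) i (inv n) ⟩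
  i * (ι (suc n) * inv n)  ≡⟨ cong (i *_) (ι-inv n) ⟩
  i * 1ℚ                   ≡⟨ *-identityʳ i ⟩
  i                        ∎)
  where
  open ≡-Reasoning
  i = inv (n ℕ.+ m ℕ.* suc n)

step-refine : ∀ q m n → 0ℚ < step q m → 0ℚ < step q (n ℕ.+ m ℕ.* suc n)
step-refine q m n h = subst (0ℚ <_)
  (trans (solve 3 (λ q a b → (con 1ℚ :+ q :* a) :* b :+ (con 1ℚ :- b) := con 1ℚ :+ q :* (a :* b)) refl q (inv m) (inv n))
         (cong (λ z → 1ℚ + q * z) (sym (inv-*′ m n))))
  (pos+ (pos* h (inv>0 n)) (sub≤ (inv≤1 n)))

compound-refine : ∀ q m n → 0ℚ < step q m → compound q m ≤ compound q (n ℕ.+ m ℕ.* suc n)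
compound-refine q m n h = subst (compound q m ≤_)
  (trans (^-assocʳ s (suc n) (suc m)) (cong (s ^_) (ℕ.*-comm (suc n) (suc m))))
  (pow-mono (suc m) (<⇒≤ h) (subst (_≤ s ^ suc n) eq (bernoulli (suc n) (<⇒≤ (step-refine q m n h)) (sq≥0 (q * i)))))
  where
  i = inv (n ℕ.+ m ℕ.* suc n)
  s = step q (n ℕ.+ m ℕ.* suc n)
  eq : 1ℚ + ι (suc n) * (q * i) ≡ step q m
  eq = cong (1ℚ +_) (trans (solve 3 (λ k q i → k :* (q :* i) := q :* (k :* i)) refl (ι (suc n)) q i) (cong (q *_) (sym (inv-* m n))))

step-step : ∀ q n → step q n * step (- q) n ≡ 1ℚ - (q * inv n) * (q * inv n)
step-step q n = solve 2 (λ q i → (con 1ℚ :+ q :* i) :* (con 1ℚ :+ (:- q) :* i) := con 1ℚ :- (q :* i) :* (q :* i)) refl q (inv n)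

compound-same : ∀ q n → 0ℚ < step q n → 0ℚ < step (- q) n → compound q n * compound (- q) n ≤ 1ℚ
compound-same q n h g = subst (_≤ 1ℚ) (^-distrib-* (step q n) (step (- q) n) (suc n))
  (pow≤1 (suc n) (<⇒≤ (pos* h g)) (subst (_≤ 1ℚ) (sym (step-step q n))
    (le (subst (0ℚ ≤_) (solve 1 (λ z → z := con 1ℚ :- (con 1ℚ :- z)) refl z²) (sq≥0 (q * inv n))))))
  where z² = (q * inv n) * (q * inv n)

compound-swap : ∀ q m n → compound q (m ℕ.+ n ℕ.* suc m) ≡ compound q (n ℕ.+ m ℕ.* suc n)
compound-swap q m n = cong (compound q) (ℕ.suc-injective (ℕ.*-comm (suc n) (suc m)))

compound-cross : ∀ q m n → 0ℚ < step q m → 0ℚ < step (- q) n → compound q m * compound (- q) n ≤ 1ℚ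
compound-cross q m n h g = ≤-trans
  (*≤ʳ (<⇒≤ (pow>0 (suc n) g)) (compound-refine q m n h))
  (≤-trans (*≤ˡ (<⇒≤ (pow>0 (suc k) (step-refine q m n h)))
    (≤-trans (compound-refine (- q) n m g) (≤-reflexive (compound-swap (- q) m n))))
   (compound-same q k (step-refine q m n h) g′))
  where
  k = n ℕ.+ m ℕ.* suc n
  g′ : 0ℚ < step (- q) k
  g′ = subst (λ j → 0ℚ < step (- q) j) (ℕ.suc-injective (ℕ.*-comm (suc n) (suc m))) (step-refine (- q) n m g)

arch-inv : ∀ {x y n} → 0ℚ < y → ∀ {i} → 0ℚ < i → i * y ≡ 1ℚ → x * i < ι (suc n) → x * inv n < y
arch-inv {x} {y} {n} 0<y {i} 0<i iy h = subst₂ _<_ lhs rhs (*<ʳ (pos* 0<y (inv>0 n)) h)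
  where
  lhs : x * i * (y * inv n) ≡ x * inv n
  lhs = trans (solve 4 (λ x i y n → x :* i :* (y :* n) := i :* y :* (x :* n)) refl x i y (inv n))
              (trans (cong (_* (x * inv n)) iy) (*-identityˡ _))
  rhs : ι (suc n) * (y * inv n) ≡ y
  rhs = trans (solve 3 (λ k y n → k :* (y :* n) := k :* n :* y) refl (ι (suc n)) y (inv n))
              (trans (cong (_* y) (ι-inv n)) (*-identityˡ y))

arch₃ : ∀ p q x {y} → 0ℚ < y → ∃ λ n → p < ι (suc n) × q < ι (suc n) × x * inv n < y
arch₃ p q x 0<y =
  let i , 0<i , iy = inverse 0<y
      n , h = arch (p ⊔ (q ⊔ (x * i)))
  in n , ≤-<-trans (p≤max₁ p q (x * i)) h , ≤-<-trans (p≤max₂ p q (x * i)) h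
       , arch-inv {x} {n = n} 0<y 0<i iy (≤-<-trans (p≤max₃ p q (x * i)) h)

exp-located : ∀ q {r s} → r < s →
  (∃ λ n → 0ℚ < step q n × r < compound q n) ⊎ (∃ λ n → 0ℚ < step (- q) n × 1ℚ < s * compound (- q) n)
exp-located q {r} {s} r<s with 0ℚ <? s
... | no s≤0 = let n , h = arch (- q) in
  inj₁ (n , step>0 q n h , <-trans (<-≤-trans r<s (≮⇒≥ s≤0)) (pow>0 (suc n) (step>0 q n h)))
... | yes 0<s =
  let n , h , g , l = arch₃ (- q) (- (- q)) (s * (q * q)) (sub r<s)
  in decide n (step>0 q n h) (step>0 (- q) n g) l (r <? compound q n) (1ℚ <? s * compound (- q) n)
  where
  decide : ∀ n → 0ℚ < step q n → 0ℚ < step (- q) n → s * (q * q) * inv n < s - r →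
    Dec (r < compound q n) → Dec (1ℚ < s * compound (- q) n) →
    (∃ λ n → 0ℚ < step q n × r < compound q n) ⊎ (∃ λ n → 0ℚ < step (- q) n × 1ℚ < s * compound (- q) n)
  decide n h g l (yes p) _ = inj₁ (n , h , p)
  decide n h g l (no _) (yes p) = inj₂ (n , g , p)
  decide n h g l (no p) (no p′) = ⊥-elim (<-irrefl refl (<-≤-trans low high))
    where
    C = compound q n
    D = compound (- q) n
    high : s * (C * D) ≤ r
    high = ≤-trans (≤-reflexive (solve 3 (λ s c d → s :* (c :* d) := s :* d :* c) refl s C D))
      (≤-trans (*≤ʳ (<⇒≤ (pow>0 (suc n) h)) (≮⇒≥ p′)) (≤-trans (≤-reflexive (*-identityˡ C)) (≮⇒≥ p)))
    z = q * inv n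
    bern : 1ℚ + ι (suc n) * (- (z * z)) ≤ C * D
    bern = ≤-trans (bernoulli (suc n) (subst (0ℚ ≤_) (step-step q n) (<⇒≤ (pos* h g))) (sq≥0 (- (z * z))))
      (≤-reflexive (trans (cong (_^ suc n) (sym (step-step q n))) (^-distrib-* (step q n) (step (- q) n) (suc n))))
    low : r < s * (C * D)
    low = <-≤-trans (lt (subst (0ℚ <_) eq (sub l))) (*≤ˡ (<⇒≤ 0<s) bern)
      where
      eq : s - r - s * (q * q) * inv n ≡ s * (1ℚ + ι (suc n) * (- (z * z))) - r
      eq = trans (cong (λ j → s - r - s * (q * q) * j) (sym (trans (cong (_* inv n) (ι-inv n)) (*-identityˡ (inv n)))))
        (solve 5 (λ s r q k i → s :- r :- s :* (q :* q) :* (k :* i :* i) := s :* (con 1ℚ :+ k :* (:- ((q :* i) :* (q :* i)))) :- r)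
          refl s r q (ι (suc n)) (inv n))

-- With N = suc n, (1 + q/N)ᴺ increases to e^q over N > -q, and (1 - q/N)⁻ᴺ
-- decreases to e^q over N > q; the side conditions say the bases are positive.
exp : ℚ → ℝ
exp q .lower r = ∃ λ n → 0ℚ < step q n × r < compound q n
exp q .upper r = ∃ λ n → 0ℚ < step (- q) n × 1ℚ < r * compound (- q) n
exp q .lower-inhabited = let n , h = arch (- q) in 0ℚ , n , step>0 q n h , pow>0 (suc n) (step>0 q n h)
exp q .upper-inhabited =
  let n , h = arch (- (- q))
      i , _ , ic = inverse (pow>0 (suc n) (step>0 (- q) n h))
  in i + i , n , step>0 (- q) n h , subst (1ℚ <_) (trans (cong₂ _+_ (sym ic) (sym ic)) (sym (*-distribʳ-+ (compound (- q) n) i i))) (lt 0<1)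
exp q .lower-closed h (n , g , l) = n , g , <-trans h l
exp q .upper-closed h (n , g , l) = n , g , <-trans l (*<ʳ (pow>0 (suc n) g) h)
exp q .lower-open (n , g , l) = let r , a , b = <-dense l in r , a , n , g , b
exp q .upper-open (n , g , l) = let r , a , b = shrink (pow>0 (suc n) g) l in r , a , n , g , b
exp q .disjoint {r} (n , h , l) (m , g , k) =
  <-irrefl refl (<-≤-trans (<-trans k (*<ʳ (pow>0 (suc m) g) l)) (compound-cross q n m h g))
exp q .located = exp-located q

step-mono : ∀ {q r} n → q < r → step q n < step r n
step-mono n h = +-monoʳ-< 1ℚ (*<ʳ (inv>0 n) h)

compound-mono : ∀ {q r} n → 0ℚ < step q n → q < r → compound q n ≤ compound r n
compound-mono {q} {r} n h g = pow-mono (suc n) (<⇒≤ h) (<⇒≤ (step-mono {q} {r} n g))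

unstep : ∀ x n {s} → s < step x n → ∃ λ y → y < x × step y n ≡ s
unstep x n {s} h = y , cancel<ʳ (inv>0 n) (subst₂ _<_ (sym yi) xi (+-monoˡ-< (- 1ℚ) h)) ,
                   trans (cong (1ℚ +_) yi) (solve 1 (λ s → con 1ℚ :+ (s :- con 1ℚ) := s) refl s)
  where
  y = (s - 1ℚ) * ι (suc n)
  yi : y * inv n ≡ s - 1ℚ
  yi = trans (*-assoc (s - 1ℚ) _ _) (trans (cong ((s - 1ℚ) *_) (ι-inv n)) (*-identityʳ (s - 1ℚ)))
  xi : step x n - 1ℚ ≡ x * inv n
  xi = solve 1 (λ z → con 1ℚ :+ z :- con 1ℚ := z) refl (x * inv n)

neg-swap : ∀ {p q} → p < - q → q < - p
neg-swap {p} {q} h = subst (_< - p) (solve 1 (λ q → :- (:- q) := q) refl q) (neg-antimono-< h)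

neg-neg : ∀ p → - (- p) ≡ p
neg-neg = solve 1 (λ p → :- (:- p) := p) refl

exp-upper>0 : ∀ {q r} → exp q .upper r → 0ℚ < r
exp-upper>0 {q} {r} h = let n , g = arch (- q) in lower<upper (exp q) (n , step>0 q n g , pow>0 (suc n) (step>0 q n g)) h

log-located : ∀ x {a b} → a < b → exp a <ℝ x ⊎ x <ℝ exp b
log-located x {a} {b} a<b = decide choice
  where
  C D : ℕ → ℚ
  C = compound b
  D = compound (- a)
  product>1 : ∀ n → a * b * inv n < b - a → 1ℚ < step b n * step (- a) n
  product>1 n l = lt (subst (0ℚ <_)
    (solve 3 (λ a b i → (b :- a :- a :* b :* i) :* i := (con 1ℚ :+ b :* i) :* (con 1ℚ :+ (:- a) :* i) :- con 1ℚ) refl a b (inv n))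
    (pos* (sub l) (inv>0 n)))
  gap : ∀ n → 1ℚ < step b n * step (- a) n → 1ℚ < C n * D n
  gap n h = subst (1ℚ <_) (^-distrib-* (step b n) (step (- a) n) (suc n)) (pow>1 n h)
  conclude : ∀ n {w₁ w₂} → 0ℚ < step (- a) n → 0ℚ < step b n → 1ℚ < w₁ * D n → w₂ < C n →
             lower x w₁ ⊎ upper x w₂ → exp a <ℝ x ⊎ x <ℝ exp b
  conclude n {w₁} s v p q (inj₁ m) = inj₁ (w₁ , (n , s , p) , m)
  conclude n {w₂ = w₂} s v p q (inj₂ m) = inj₂ (w₂ , m , n , v , q)
  finish : ∀ n → 0ℚ < step (- a) n → 0ℚ < step b n →
           (∃ λ w₂ → w₂ < C n × 1ℚ < w₂ * D n) → exp a <ℝ x ⊎ x <ℝ exp b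
  finish n s v (w₂ , w₂<C , h) = go (shrink {1ℚ} {w₂} {D n} (pow>0 (suc n) s) h)
    where
    go : (∃ λ w₁ → w₁ < w₂ × 1ℚ < w₁ * D n) → exp a <ℝ x ⊎ x <ℝ exp b
    go (w₁ , w₁<w₂ , h₁) = conclude n s v h₁ w₂<C (located x w₁<w₂)
  choice : ∃ λ n → - (- a) < ι (suc n) × - b < ι (suc n) × a * b * inv n < b - a
  choice = arch₃ (- (- a)) (- b) (a * b) (sub a<b)
  steps : ∀ n → - (- a) < ι (suc n) → - b < ι (suc n) → 0ℚ < step (- a) n × 0ℚ < step b n
  steps n h g = step>0 (- a) n h , step>0 b n g
  separate : ∀ n → 0ℚ < step (- a) n → a * b * inv n < b - a → ∃ λ w₂ → w₂ < C n × 1ℚ < w₂ * D n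
  separate n s l = shrink {1ℚ} {C n} {D n} (pow>0 (suc n) s) (gap n (product>1 n l))
  decide : (∃ λ n → - (- a) < ι (suc n) × - b < ι (suc n) × a * b * inv n < b - a) → exp a <ℝ x ⊎ x <ℝ exp b
  decide (n , h , g , l) = finish n (proj₁ (steps n h g)) (proj₂ (steps n h g)) (separate n (proj₁ (steps n h g)) l)

step₀ : ∀ q → step q 0 ≡ 1ℚ + q
step₀ q = cong (1ℚ +_) (*-identityʳ q)

compound₀ : ∀ q → compound q 0 ≡ 1ℚ + q
compound₀ q = trans (*-identityʳ (step q 0)) (step₀ q)

exp-upper₀ : ∀ q r → 0ℚ < 1ℚ - q → 1ℚ < r * (1ℚ - q) → exp q .upper r
exp-upper₀ q r h g = 0 , subst (0ℚ <_) (sym (step₀ (- q))) h , subst (λ z → 1ℚ < r * z) (sym (compound₀ (- q))) g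

exp-lower₀ : ∀ q r → 0ℚ < 1ℚ + q → r < 1ℚ + q → exp q .lower r
exp-lower₀ q r h g = 0 , subst (0ℚ <_) (sym (step₀ q)) h , subst (r <_) (sym (compound₀ q)) g

exp-small : ∀ r → 0ℚ < r → ∃ λ q → exp q .upper r
exp-small r 0<r = go (inverse 0<r)
  where
  go : (∃ λ i → 0ℚ < i × i * r ≡ 1ℚ) → ∃ λ q → exp q .upper r
  go (i , 0<i , ir) = - i , exp-upper₀ (- i) r
    (subst (λ z → 0ℚ < 1ℚ + z) (sym (neg-neg i)) (pos+ 0<1 (<⇒≤ 0<i)))
    (subst (λ z → 1ℚ < r * (1ℚ + z)) (sym (neg-neg i)) (subst (1ℚ <_) eq 1<r+1))
    where
    eq : r + 1ℚ ≡ r * (1ℚ + i)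
    eq = trans (cong (r +_) (sym ir)) (solve 2 (λ r i → r :+ i :* r := r :* (con 1ℚ :+ i)) refl r i)
    1<r+1 : 1ℚ < r + 1ℚ
    1<r+1 = lt (subst (0ℚ <_) (solve 1 (λ r → r := r :+ con 1ℚ :- con 1ℚ) refl r) 0<r)

exp-large : ∀ r → 0ℚ < r → exp r .lower r
exp-large r 0<r = exp-lower₀ r r (pos+ 0<1 (<⇒≤ 0<r))
  (lt (subst (0ℚ <_) (solve 1 (λ r → con 1ℚ := con 1ℚ :+ r :- r) refl r) 0<1))

exp-upper-anti : ∀ {q r w} → q < r → exp r .upper w → exp q .upper w
exp-upper-anti {q} {r} {w} q<r (n , h , l) =
  n , <-trans h (step-mono { - r} { - q} n -r<-q) ,
  <-≤-trans l (*≤ˡ {w} {compound (- r) n} {compound (- q) n} (<⇒≤ (exp-upper>0 {r} {w} (n , h , l))) (compound-mono { - r} { - q} n h -r<-q))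
  where
  -r<-q : - r < - q
  -r<-q = neg-antimono-< q<r

exp-lower-mono : ∀ {q r w} → q < r → exp q .lower w → exp r .lower w
exp-lower-mono {q} {r} {w} q<r (n , h , l) = n , <-trans h (step-mono {q} {r} n q<r) , <-≤-trans l (compound-mono {q} {r} n h q<r)

exp-upper-open : ∀ {q w} → exp q .upper w → ∃ λ r → q < r × exp r .upper w
exp-upper-open {q} {w} (n , h , l) = go (shrink^ {1ℚ} {w} {step (- q) n} (suc n) (exp-upper>0 {q} {w} (n , h , l)) h l)
  where
  back : ∀ {s} → 0ℚ < s → 1ℚ < w * s ^ suc n → (∃ λ y → y < - q × step y n ≡ s) → ∃ λ r → q < r × exp r .upper w
  back 0<s g (y , y<-q , refl) = - y , neg-swap y<-q , n ,
    subst (λ z → 0ℚ < step z n) (sym (neg-neg y)) 0<s ,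
    subst (λ z → 1ℚ < w * compound z n) (sym (neg-neg y)) g
  go : (∃ λ s → s < step (- q) n × 0ℚ < s × 1ℚ < w * s ^ suc n) → ∃ λ r → q < r × exp r .upper w
  go (s , s<S , 0<s , g) = back 0<s g (unstep (- q) n s<S)

exp-lower-open : ∀ {q w} → exp q .lower w → ∃ λ r → r < q × exp r .lower w
exp-lower-open {q} {w} (n , h , l) =
  go (shrink^ {w} {1ℚ} {step q n} (suc n) 0<1 h (subst (w <_) (sym (*-identityˡ (compound q n))) l))
  where
  back : ∀ {s} → 0ℚ < s → w < s ^ suc n → (∃ λ y → y < q × step y n ≡ s) → ∃ λ r → r < q × exp r .lower w
  back 0<s g (y , y<q , refl) = y , y<q , n , 0<s , g
  go : (∃ λ s → s < step q n × 0ℚ < s × w < 1ℚ * s ^ suc n) → ∃ λ r → r < q × exp r .lower w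
  go (s , s<S , 0<s , g) = back 0<s (subst (w <_) (*-identityˡ (s ^ suc n)) g) (unstep q n s<S)

-- The natural logarithm as the inverse of exp: q < log x iff e^q < x, and
-- log x < q iff x < e^q.
log : (x : ℝ) → 0ℝ <ℝ x → ℝ
log x 0<x .lower q = exp q <ℝ x
log x 0<x .upper q = x <ℝ exp q
log x (s , 0<s , xs) .lower-inhabited = let q , h = exp-small s 0<s in q , s , h , xs
log x (s , 0<s , xs) .upper-inhabited =
  let r , xr = upper-inhabited x in r , r , xr , exp-large r (<-trans 0<s (lower<upper x xs xr))
log x 0<x .lower-closed {q} {r} q<r (w , h , xw) = w , exp-upper-anti {q} {r} {w} q<r h , xw
log x 0<x .upper-closed {q} {r} q<r (w , xw , h) = w , xw , exp-lower-mono {q} {r} {w} q<r h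
log x 0<x .lower-open {q} (w , h , xw) = let r , q<r , g = exp-upper-open {q} {w} h in r , q<r , w , g , xw
log x 0<x .upper-open {q} (w , xw , h) = let r , r<q , g = exp-lower-open {q} {w} h in r , r<q , w , xw , g
log x 0<x .disjoint {q} = <ℝ-asym (exp q) x
log x 0<x .located = log-located x

log>0 : ∀ {x} (0<x : 0ℝ <ℝ x) → 1ℝ <ℝ x → 0ℝ <ℝ log x 0<x
log>0 {x} _ (u , 1<u , xu) = go (shrink {1ℚ} {1ℚ} {u} 0<u (subst (1ℚ <_) (sym (*-identityˡ u)) 1<u))
  where
  0<u : 0ℚ < u
  0<u = <-trans 0<1 1<u
  go : (∃ λ s → s < 1ℚ × 1ℚ < s * u) → ∃ λ q → 0ℚ < q × exp q <ℝ x
  go (s , s<1 , h) = 1ℚ - s , sub s<1 , u , exp-upper₀ (1ℚ - s) u (subst (0ℚ <_) eq 0<s) 1<u[1-q] , xu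
    where
    0<s : 0ℚ < s
    0<s = cancel<ʳ 0<u (subst (_< s * u) (sym (*-zeroˡ u)) (<-trans 0<1 h))
    eq : s ≡ 1ℚ - (1ℚ - s)
    eq = solve 1 (λ s → s := con 1ℚ :- (con 1ℚ :- s)) refl s
    1<u[1-q] : 1ℚ < u * (1ℚ - (1ℚ - s))
    1<u[1-q] = subst (1ℚ <_) (trans (*-comm s u) (cong (u *_) eq)) h

fromℕ-< : ∀ {m n} → m ℕ.< n → fromℕ m <ℝ fromℕ n
fromℕ-< {m} {n} m<n = <-dense (lt (<-≤-trans 0<1 (le (subst (0ℚ ≤_)
  (trans (cong (λ z → ι n - z) (ι-suc m)) (solve 2 (λ m n → n :- (con 1ℚ :+ m) := n :- m :- con 1ℚ) refl (ι m) (ι n))) (sub≤ (ι-mono m<n))))))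

logℕ : (n : ℕ) → 1 ℕ.< n → ℝ
logℕ n 1<n = log (fromℕ n) (fromℕ-< (ℕ.<-trans ℕ.z<s 1<n))

loglogℕ : (n : ℕ) → 1 ℕ.< n → ℝ
loglogℕ n 1<n = log (logℕ n 1<n) (log>0 {fromℕ n} (fromℕ-< (ℕ.<-trans ℕ.z<s 1<n)) (fromℕ-< 1<n))

-- The last condition says that {c , d} and {a , b} differ as multisets.
NoUniqueSum : ∀ {c ℓ a} (G : AbelianGroup c ℓ) → Pred (AbelianGroup.Carrier G) a → Set (c ⊔ˡ ℓ ⊔ˡ a)
NoUniqueSum G A =
  ∀ a b → A a → A b → ∃₂ λ c d →
    A c × A d × a ∙ b ≈ c ∙ d × ¬ ((a ≈ c × b ≈ d) ⊎ (a ≈ d × b ≈ c))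
  where open AbelianGroup G

module _ (n : ℕ) .{{_ : ℕ.NonZero n}} where

  private
    infixl 6 _⊕_
    _⊕_ : Fin n → Fin n → Fin n
    i ⊕ j = (toℕ i ℕ.+ toℕ j) mod n

    zeroₙ : Fin n
    zeroₙ = 0 mod n

    ⊖_ : Fin n → Fin n
    ⊖ i = (n ℕ.∸ toℕ i) mod n

    toℕ-mod : ∀ k → toℕ (k mod n) ≡ k % n
    toℕ-mod k = toℕ-fromℕ< (m%n<n k n)

    toℕ-% : ∀ (i : Fin n) → toℕ i % n ≡ toℕ i
    toℕ-% i = m<n⇒m%n≡m (toℕ<n i)

    0%n≡0 : 0 % n ≡ 0
    0%n≡0 = m<n⇒m%n≡m (ℕ.>-nonZero⁻¹ n)

    %-absorbˡ : ∀ a b → (a % n ℕ.+ b) % n ≡ (a ℕ.+ b) % n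
    %-absorbˡ a b = begin
      (a % n ℕ.+ b) % n            ≡⟨ %-distribˡ-+ (a % n) b n ⟩
      (a % n % n ℕ.+ b % n) % n    ≡⟨ cong (λ z → (z ℕ.+ b % n) % n) (m%n%n≡m%n a n) ⟩
      (a % n ℕ.+ b % n) % n        ≡⟨ sym (%-distribˡ-+ a b n) ⟩
      (a ℕ.+ b) % n                ∎
      where open ≡-Reasoning

    ⊕-mod : ∀ k j → (k mod n) ⊕ j ≡ (k ℕ.+ toℕ j) mod n
    ⊕-mod k j = toℕ-injective (begin
      toℕ ((k mod n) ⊕ j)             ≡⟨ toℕ-mod _ ⟩
      (toℕ (k mod n) ℕ.+ toℕ j) % n   ≡⟨ cong (λ z → (z ℕ.+ toℕ j) % n) (toℕ-mod k) ⟩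
      (k % n ℕ.+ toℕ j) % n           ≡⟨ %-absorbˡ k (toℕ j) ⟩
      (k ℕ.+ toℕ j) % n               ≡⟨ sym (toℕ-mod _) ⟩
      toℕ ((k ℕ.+ toℕ j) mod n)       ∎)
      where open ≡-Reasoning

    ⊕-comm : ∀ i j → i ⊕ j ≡ j ⊕ i
    ⊕-comm i j = cong (_mod n) (ℕ.+-comm (toℕ i) (toℕ j))

    ⊕-assoc : ∀ i j k → (i ⊕ j) ⊕ k ≡ i ⊕ (j ⊕ k)
    ⊕-assoc i j k = begin
      (i ⊕ j) ⊕ k                               ≡⟨ ⊕-mod (toℕ i ℕ.+ toℕ j) k ⟩
      (toℕ i ℕ.+ toℕ j ℕ.+ toℕ k) mod n         ≡⟨ cong (_mod n) (trans (ℕ.+-assoc (toℕ i) (toℕ j) (toℕ k)) (ℕ.+-comm (toℕ i) (toℕ j ℕ.+ toℕ k))) ⟩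
      (toℕ j ℕ.+ toℕ k ℕ.+ toℕ i) mod n         ≡⟨ sym (⊕-mod (toℕ j ℕ.+ toℕ k) i) ⟩
      (j ⊕ k) ⊕ i                               ≡⟨ ⊕-comm (j ⊕ k) i ⟩
      i ⊕ (j ⊕ k)                               ∎
      where open ≡-Reasoning

    ⊕-identityˡ : ∀ i → zeroₙ ⊕ i ≡ i
    ⊕-identityˡ i = toℕ-injective (trans (cong toℕ (⊕-mod 0 i)) (trans (toℕ-mod (toℕ i)) (toℕ-% i)))

    ⊕-inverseˡ : ∀ i → (⊖ i) ⊕ i ≡ zeroₙ
    ⊕-inverseˡ i = begin
      (⊖ i) ⊕ i                       ≡⟨ ⊕-mod (n ℕ.∸ toℕ i) i ⟩
      (n ℕ.∸ toℕ i ℕ.+ toℕ i) mod n   ≡⟨ cong (_mod n) (ℕ.m∸n+n≡m (ℕ.<⇒≤ (toℕ<n i))) ⟩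
      n mod n                         ≡⟨ toℕ-injective (trans (toℕ-mod n) (trans (trans (n%n≡0 n) (sym 0%n≡0)) (sym (toℕ-mod 0)))) ⟩
      zeroₙ                           ∎
      where open ≡-Reasoning

  -- addition modulo n on {0 , … , n - 1}
  ℤ/ : AbelianGroup _ _
  ℤ/ = record
    { Carrier = Fin n
    ; _≈_ = _≡_
    ; _∙_ = _⊕_
    ; ε = zeroₙ
    ; _⁻¹ = ⊖_
    ; isAbelianGroup = record
      { isGroup = record
        { isMonoid = record
          { isSemigroup = record
            { isMagma = record { isEquivalence = isEquivalence ; ∙-cong = cong₂ _⊕_ }
            ; assoc = ⊕-assoc }
          ; identity = ⊕-identityˡ , λ i → trans (⊕-comm i zeroₙ) (⊕-identityˡ i) }
        ; inverse = ⊕-inverseˡ , λ i → trans (⊕-comm i (⊖ i)) (⊕-inverseˡ i)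
        ; ⁻¹-cong = cong ⊖_ }
      ; comm = ⊕-comm } }

  Admissible : Subset n → Set
  Admissible A = 2 ℕ.≤ ∣ A ∣ × NoUniqueSum ℤ/ (_∈ A)

  admissible? : ∀ A → Dec (Admissible A)
  admissible? A = 2 ℕ.≤? ∣ A ∣ ×-dec
    all? λ a → all? λ b → (a ∈? A) →-dec ((b ∈? A) →-dec
      any? λ c → any? λ d → (c ∈? A) ×-dec (d ∈? A) ×-dec (a ⊕ b FinP.≟ c ⊕ d) ×-dec
        ¬? (((a FinP.≟ c) ×-dec (b FinP.≟ d)) ⊎-dec ((a FinP.≟ d) ×-dec (b FinP.≟ c))))

  -- a + b = (a + t) + (b - t), where t ∉ {0 , b - a}
  full-admissible : 3 ℕ.≤ n → Admissible ⊤
  full-admissible 3≤n = subst (2 ℕ.≤_) (sym (∣⊤∣≡n n)) (ℕ.<⇒≤ 3≤n) , λ a b _ _ → choose a b (one FinP.≟ (⊖ a) ⊕ b)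
    where
    open AbelianGroup ℤ/ using (_∙_; ε; _⁻¹; group)
    open import Algebra.Properties.Group group using (∙-cancelˡ)
    open ≡-Reasoning
    one two : Fin n
    one = 1 mod n
    two = 2 mod n
    one≢0 : ¬ one ≡ zeroₙ
    one≢0 e with trans (sym (m<n⇒m%n≡m (ℕ.<⇒≤ 3≤n))) (trans (sym (toℕ-mod 1)) (trans (cong toℕ e) (trans (toℕ-mod 0) 0%n≡0)))
    ... | ()
    two≢0 : ¬ two ≡ zeroₙ
    two≢0 e with trans (sym (m<n⇒m%n≡m 3≤n)) (trans (sym (toℕ-mod 2)) (trans (cong toℕ e) (trans (toℕ-mod 0) 0%n≡0)))
    ... | ()
    two≢one : ¬ two ≡ one
    two≢one e with trans (sym (m<n⇒m%n≡m 3≤n)) (trans (sym (toℕ-mod 2)) (trans (cong toℕ e) (trans (toℕ-mod 1) (m<n⇒m%n≡m (ℕ.<⇒≤ 3≤n)))))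
    ... | ()
    Other : Fin n → Fin n → Set
    Other a b = ∃₂ λ c d → c ∈ ⊤ × d ∈ ⊤ × a ⊕ b ≡ c ⊕ d × ¬ ((a ≡ c × b ≡ d) ⊎ (a ≡ d × b ≡ c))
    shift : ∀ a b t → ¬ t ≡ zeroₙ → ¬ t ≡ (⊖ a) ⊕ b → Other a b
    shift a b t t≢0 t≢b-a = a ⊕ t , b ⊕ (⊖ t) , ∈⊤ , ∈⊤ , sym same , λ
      { (inj₁ (e , _)) → t≢0 (∙-cancelˡ a t zeroₙ (trans (sym e) (sym (identityʳ a))))
      ; (inj₂ (_ , e)) → t≢b-a (trans (sym (trans (sym (⊕-assoc (⊖ a) a t)) (trans (cong (_⊕ t) (⊕-inverseˡ a)) (⊕-identityˡ t)))) (cong ((⊖ a) ⊕_) (sym e))) }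
      where
      identityʳ : ∀ i → i ⊕ zeroₙ ≡ i
      identityʳ i = trans (⊕-comm i zeroₙ) (⊕-identityˡ i)
      same : (a ⊕ t) ⊕ (b ⊕ (⊖ t)) ≡ a ⊕ b
      same = begin
        (a ⊕ t) ⊕ (b ⊕ (⊖ t))   ≡⟨ cong ((a ⊕ t) ⊕_) (⊕-comm b (⊖ t)) ⟩
        (a ⊕ t) ⊕ ((⊖ t) ⊕ b)   ≡⟨ ⊕-assoc a t ((⊖ t) ⊕ b) ⟩
        a ⊕ (t ⊕ ((⊖ t) ⊕ b))   ≡⟨ cong (a ⊕_) (sym (⊕-assoc t (⊖ t) b)) ⟩
        a ⊕ ((t ⊕ (⊖ t)) ⊕ b)   ≡⟨ cong (λ z → a ⊕ (z ⊕ b)) (trans (⊕-comm t (⊖ t)) (⊕-inverseˡ t)) ⟩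
        a ⊕ (zeroₙ ⊕ b)         ≡⟨ cong (a ⊕_) (⊕-identityˡ b) ⟩
        a ⊕ b                   ∎
    choose : ∀ a b → Dec (one ≡ (⊖ a) ⊕ b) → Other a b
    choose a b (no ne) = shift a b one one≢0 ne
    choose a b (yes e) = shift a b two two≢0 (λ e′ → two≢one (trans e′ (sym e)))

  IsMinimumSize : ℕ → Set
  IsMinimumSize k = (∃ λ A → Admissible A × ∣ A ∣ ≡ k) × (∀ A → Admissible A → k ℕ.≤ ∣ A ∣)

  minimum-exists : 3 ℕ.≤ n → ∃ IsMinimumSize
  minimum-exists 3≤n = search (<-wellFounded ∣ ⊤ {n} ∣) ⊤ (full-admissible 3≤n) refl
    where
    search : ∀ {k} → Acc ℕ._<_ k → ∀ A → Admissible A → ∣ A ∣ ≡ k → ∃ IsMinimumSize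
    search {k} (acc rec) A adm e with anySubset? (λ B → admissible? B ×-dec (∣ B ∣ ℕ.<? k))
    ... | yes (B , adm′ , B<k) = search (rec B<k) B adm′ refl
    ... | no none = k , (A , adm , e) , λ B adm′ → ℕ.≮⇒≥ (λ B<k → none (B , adm′ , B<k))

prime>1 : ∀ {p} → Prime p → 1 ℕ.< p
prime>1 pr = ℕ.nonTrivial⇒n>1 _ {{prime⇒nonTrivial pr}}

m : ∀ p → Prime p → 3 ℕ.≤ p → ℕ
m p pr 3≤p = proj₁ (minimum-exists p {{prime⇒nonZero pr}} 3≤p)

m-isMinimum : ∀ p pr 3≤p → IsMinimumSize p {{prime⇒nonZero pr}} (m p pr 3≤p)
m-isMinimum p pr 3≤p = proj₂ (minimum-exists p {{prime⇒nonZero pr}} 3≤p)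

{-# OPTIONS --safe #-}
-- Write A = {e x : x < k}, and suppose that p exceeds roughly 32^(4q) (16k)^(ℓ⁵) with q ≈ k / ℓ.  By
-- Dirichlet's theorem a dilation then moves any q elements of A close to 0, together with any ℓ⁵ further
-- residues, which can even be moved within p / (16k) of 0.  If this always forces all of A close to 0,
-- then the largest element of the dilate has a unique double, a contradiction; so A must not be
-- controlled by so few elements and residues.
--
-- Let S be a set of differences of A, and join x and y when e y − e x ∈ ± S.  A dilation making S small
-- orients these edges without cycles, so it suffices to control the top vertices, those without an
-- upward edge.  Top vertices of degree at least ℓ are controlled by a maximal family with disjoint
-- neighbourhoods, which has at most k / ℓ members.  If a and b are top and a + b = c + d, then neither
-- bc nor bd is an edge.  So suppose that there are q top vertices b of degree below ℓ, and
-- look at the pairs {c , d} obtained from them for each top a.  Either some a has a set U of at most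
-- ℓ³ + ℓ vertices meeting all its pairs; adding the differences e a − e u, u ∈ U, to S raises the degrees
-- of all q vertices b, which can happen at most ℓ² times.  Or a greedily chosen set C of q vertices
-- meets the pairs of almost every a in ℓ vertices, whence a = c + d − b with c ∈ C; these a are again
-- controlled by a maximal family with disjoint sets of such d.  Finally ℓ ≈ log₂ log₂ p gives the bound.
module Submission where

open import Defs
open import Algebra.Bundles using (CommutativeRing)
import Algebra.Properties.CommutativeMonoid.Sum as Sum
import Algebra.Properties.CommutativeSemiring.Exp as Exp
open import Data.Bool.Base using (Bool; true; false; if_then_else_; T)
open import Data.Empty using (⊥; ⊥-elim)
open import Data.Fin.Base using (Fin; zero; suc; toℕ; fromℕ<; combine)
import Data.Fin.Properties as Fin
open import Data.Fin.Subset using (Subset; inside; outside; _∈_; ∣_∣)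
open import Data.Integer.Base as ℤ using (ℤ; +_; -[1+_]; +[1+_])
import Data.Integer.DivMod as ℤ
open import Data.Integer.Divisibility.Signed
  using (_∣_; divides; ∣⇒∣ᵤ; ∣ᵤ⇒∣; ∣m∣n⇒∣m+n; ∣m⇒∣-m; ∣n⇒∣m*n; _∣?_)
import Data.Integer.Properties as ℤ
import Data.Integer.Solver as ℤ
open import Data.List.Base using (List; []; _∷_; _++_; length; map; allFin)
open import Data.List.Extrema ℤ.≤-totalOrder using (argmax; f[xs]≤f[argmax])
open import Data.List.Membership.Propositional using (lose) renaming (_∈_ to _∈ˡ_)
open import Data.List.Membership.Propositional.Properties using (∈-map⁺; ∈-++⁺ˡ; ∈-++⁺ʳ; ∈-allFin)
import Data.List.Properties as List
open import Data.List.Relation.Unary.All as All using (All; []; _∷_)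
import Data.List.Relation.Unary.All.Properties as All
open import Data.List.Relation.Unary.Any as Any using (Any; here; there)
import Data.List.Relation.Unary.Any.Properties as Any
import Data.Nat.Base as ℕ
import Data.Nat.Divisibility as ℕ∣
open import Data.Nat.ListAction using (product)
open import Data.Nat.Primality using (Prime; prime⇒nonZero; euclidsLemma)
import Data.Nat.Properties as ℕ
import Data.Nat.Solver as ℕ
open import Data.Product using (∃; ∃₂; _×_; _,_; proj₁; proj₂)
open import Data.Rational.Properties using (<-dense)
import Data.Rational.Solver as ℚ
open import Data.Sum using (_⊎_; inj₁; inj₂; [_,_]′; swap)
open import Data.Vec.Base using ([]; _∷_; here; there)
open import Function.Base using (_∘_; id; const)
open import Relation.Binary.PropositionalEquality
open import Relation.Nullary using (¬_; Dec; yes; no; does)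
open import Relation.Nullary.Decidable using (T?; _×-dec_; _⊎-dec_; ¬?; map′)

module N = ℕ.+-*-Solver

module Combinatorics where
  open import Data.Nat.Base
  open import Data.Nat.DivMod using (_/_; _%_; _mod_; m≡m%n+[m/n]*n; m%n<n; m/n*n≤m; m<n*o⇒m/o<n; /-monoˡ-≤)
  open import Data.Nat.Properties
  open ℤ.+-*-Solver using (solve; _:+_; _:*_; _:-_; :-_; _:=_; con)
  open Sum +-0-commutativeMonoid using (sum; ∑-distrib-+; ∑-comm)

  -- Finite sums and counting of decidable predicates.

  sum-mono : ∀ {n} {f g : Fin n → ℕ} → (∀ i → f i ≤ g i) → sum f ≤ sum g
  sum-mono {zero} h = z≤n
  sum-mono {suc n} h = +-mono-≤ (h zero) (sum-mono (h ∘ suc))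

  sum-mono-< : ∀ {n} {f g : Fin n → ℕ} → (∀ i → f i ≤ g i) → ∀ j → f j < g j → sum f < sum g
  sum-mono-< {suc n} h zero l = +-mono-<-≤ l (sum-mono (h ∘ suc))
  sum-mono-< {suc n} h (suc j) l = +-mono-≤-< (h zero) (sum-mono-< (h ∘ suc) j l)

  sum-bounded : ∀ {n} {f : Fin n → ℕ} {c} → (∀ i → f i ≤ c) → sum f ≤ n * c
  sum-bounded {zero} h = z≤n
  sum-bounded {suc n} h = +-mono-≤ (h zero) (sum-bounded (h ∘ suc))

  sum-*ʳ : ∀ {n} (f : Fin n → ℕ) c → sum (λ i → f i * c) ≡ sum f * c
  sum-*ʳ {zero} f c = refl
  sum-*ʳ {suc n} f c = trans (cong (λ n → f zero * c + n) (sum-*ʳ (f ∘ suc) c)) (sym (*-distribʳ-+ c (f zero) _))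

  large-term : ∀ {n} (f : Fin n → ℕ) {z} → n * z < sum f → ∃ λ i → z < f i
  large-term f {z} h with Fin.any? (λ i → z <? f i)
  ... | yes p = p
  ... | no ¬p = ⊥-elim (<⇒≱ h (sum-bounded (λ i → ≮⇒≥ λ l → ¬p (i , l))))

  module _ {a} {P : Set a} where
    indicator : Dec P → ℕ
    indicator d = if does d then 1 else 0

    indicator≤1 : ∀ d → indicator d ≤ 1
    indicator≤1 (yes _) = ≤-refl
    indicator≤1 (no _) = z≤n

    indicator-yes : ∀ d → P → indicator d ≡ 1
    indicator-yes (yes _) p = refl
    indicator-yes (no ¬p) p = ⊥-elim (¬p p)

    indicator-no : ∀ d → ¬ P → indicator d ≡ 0
    indicator-no (yes p) ¬p = ⊥-elim (¬p p)
    indicator-no (no _) ¬p = refl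

  indicator-mono : ∀ {a b} {P : Set a} {Q : Set b} (P? : Dec P) (Q? : Dec Q) → (P → Q) → indicator P? ≤ indicator Q?
  indicator-mono (no _) _ _ = z≤n
  indicator-mono (yes p) Q? f = ≤-reflexive (sym (indicator-yes Q? (f p)))

  # : ∀ {n a} {P : Fin n → Set a} → (∀ i → Dec (P i)) → ℕ
  # P? = sum λ i → indicator (P? i)

  module _ {n a b} {P : Fin n → Set a} {Q : Fin n → Set b} (P? : ∀ i → Dec (P i)) (Q? : ∀ i → Dec (Q i)) where
    #-mono : (∀ i → P i → Q i) → # P? ≤ # Q?
    #-mono h = sum-mono λ i → indicator-mono (P? i) (Q? i) (h i)

    #-mono-< : (∀ i → P i → Q i) → ∀ j → Q j → ¬ P j → # P? < # Q?
    #-mono-< h j q ¬p = sum-mono-< (λ i → indicator-mono (P? i) (Q? i) (h i)) j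
      (subst₂ _<_ (sym (indicator-no (P? j) ¬p)) (sym (indicator-yes (Q? j) q)) z<s)

    #-disjoint : (∀ i → P i → ¬ Q i) → # P? + # Q? ≤ # (λ i → P? i ⊎-dec Q? i)
    #-disjoint h = ≤-trans (≤-reflexive (sym (∑-distrib-+ (indicator ∘ P?) (indicator ∘ Q?))))
      (sum-mono λ i → pointwise i (P? i) (Q? i))
      where
      pointwise : ∀ i (p : Dec (P i)) (q : Dec (Q i)) → indicator p + indicator q ≤ indicator (p ⊎-dec q)
      pointwise i (yes p) (yes q) = ⊥-elim (h i p q)
      pointwise i (yes p) (no _) = ≤-refl
      pointwise i (no _) (yes q) = ≤-refl
      pointwise i (no _) (no _) = ≤-refl

  #≤n : ∀ {n a} {P : Fin n → Set a} (P? : ∀ i → Dec (P i)) → # P? ≤ n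
  #≤n {n} P? = subst (# P? ≤_) (*-identityʳ n) (sum-bounded (indicator≤1 ∘ P?))

  enumerate : ∀ {n a} {P : Fin n → Set a} (P? : ∀ i → Dec (P i)) →
              ∃ λ xs → length xs ≡ # P? × (∀ i → P i → i ∈ˡ xs) × All P xs
  enumerate {zero} P? = [] , refl , (λ ()) , []
  enumerate {suc n} P? with enumerate (P? ∘ suc)
  ... | xs , len , complete , sound with P? zero
  ...   | yes p = zero ∷ map suc xs , cong suc (trans (List.length-map suc xs) len)
                , (λ { zero _ → here refl ; (suc i) q → there (∈-map⁺ suc (complete i q)) })
                , p ∷ All.map⁺ sound
  ...   | no ¬p = map suc xs , trans (List.length-map suc xs) len
                , (λ { zero q → ⊥-elim (¬p q) ; (suc i) q → ∈-map⁺ suc (complete i q) })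
                , All.map⁺ sound

  #-none : ∀ n → # {n} (λ _ → T? false) ≡ 0
  #-none zero = refl
  #-none (suc n) = #-none n

  -- Exactly q members are wanted because the chosen vertices must both raise a potential by q and
  -- fit into a list of bounded length. The Boolean encoding keeps membership decidable.
  subset-of-size : ∀ {n a} {P : Fin n → Set a} (P? : ∀ i → Dec (P i)) q → q ≤ # P? →
                   ∃ λ (g : Fin n → Bool) → (∀ i → T (g i) → P i) × # (λ i → T? (g i)) ≡ q
  subset-of-size {n} P? zero h = (λ _ → false) , (λ _ ()) , #-none n
  subset-of-size {suc n} P? (suc q) h with P? zero
  ... | no ¬p with subset-of-size (P? ∘ suc) (suc q) h
  ...   | g , s , e = (λ { zero → false ; (suc i) → g i }) , (λ { (suc i) t → s i t }) , e
  subset-of-size {suc n} P? (suc q) (s≤s h) | yes p with subset-of-size (P? ∘ suc) q h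
  ...   | g , s , e = (λ { zero → true ; (suc i) → g i }) , (λ { zero _ → p ; (suc i) t → s i t }) , cong suc e

  #-witness : ∀ {n a} {P : Fin n → Set a} (P? : ∀ i → Dec (P i)) → 0 < # P? → ∃ P
  #-witness {n} P? h with large-term (indicator ∘ P?) (subst (_< # P?) (sym (*-zeroʳ n)) h)
  ... | i , l with P? i
  ...   | yes p = i , p
  #-witness P? h | i , () | no _

  -- Exchanging the order of summation: more than k z pairs spread over k values of y leave some y
  -- with more than z of them.
  double-count : ∀ {k a b} {G : Fin k → Set a} {X : Fin k → Fin k → Set b}
                 (G? : ∀ x → Dec (G x)) (X? : ∀ x y → Dec (X x y)) {v z} →
                 (∀ x → G x → v ≤ # (X? x)) → k * z < # G? * v →
                 ∃ λ y → z < # (λ x → G? x ×-dec X? x y)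
  double-count {k} {G = G} {X} G? X? {v} {z} h big = large-term _ (begin-strict
    k * z                                                          <⟨ big ⟩
    # G? * v                                                       ≡⟨ sum-*ʳ (indicator ∘ G?) v ⟨
    sum (λ x → indicator (G? x) * v)                               ≤⟨ sum-mono (λ x → row x (G? x)) ⟩
    sum (λ x → # (λ y → G? x ×-dec X? x y))                        ≡⟨ ∑-comm (λ x y → indicator (G? x ×-dec X? x y)) ⟩
    sum (λ y → # (λ x → G? x ×-dec X? x y))                        ∎)
    where
    open ≤-Reasoning
    row : ∀ x (g : Dec (G x)) → indicator g * v ≤ # (λ y → g ×-dec X? x y)
    row x (no _) = z≤n
    row x (yes g) = ≤-trans (≤-reflexive (+-identityʳ v)) (≤-trans (h x g)
      (#-mono (X? x) (λ y → yes g ×-dec X? x y) (λ _ p → g , p)))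

  -- Truncated degrees and disjoint neighbourhoods.

  module _ {k a} {N : Fin k → Fin k → Set a} (N? : ∀ x y → Dec (N x y)) (ℓ : ℕ) where
    -- Truncation at ℓ keeps the sum at most k ℓ, which bounds the number of rounds in an iteration,
    -- yet still registers every new neighbour of a vertex of degree below ℓ.
    potential : ℕ
    potential = sum λ x → ℓ ⊓ # (N? x)

    potential≤ : potential ≤ k * ℓ
    potential≤ = sum-bounded {k} {λ x → ℓ ⊓ # (N? x)} λ x → m⊓n≤m ℓ _

    -- E indexes a maximal family of pairwise disjoint neighbourhoods.
    dominate : 0 < ℓ → ∀ xs → All (λ x → ℓ ≤ # (N? x)) xs →
      ∃ λ E → length E * ℓ ≤ k × All (λ x → Any (λ e → ∃ λ y → N x y × N e y) E) xs
    dominate 0<ℓ xs high = let E , small , dom = build xs high in E , ≤-trans small (#≤n (covered? E)) , dom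
      where
      covered? : ∀ E y → Dec (Any (λ e → N e y) E)
      covered? E y = Any.any? (λ e → N? e y) E
      build : ∀ xs → All (λ x → ℓ ≤ # (N? x)) xs →
        ∃ λ E → length E * ℓ ≤ # (covered? E) × All (λ x → Any (λ e → ∃ λ y → N x y × N e y) E) xs
      build [] [] = [] , z≤n , []
      build (x ∷ xs) (h ∷ hs) with build xs hs
      ... | E , small , dom with Fin.any? (λ y → N? x y ×-dec covered? E y)
      ...   | yes (y , n , c) = E , small , Any.map (λ n′ → y , n , n′) c ∷ dom
      ...   | no none = x ∷ E ,
        ≤-trans (+-mono-≤ h small)
          (≤-trans (#-disjoint (N? x) (covered? E) (λ y n c → none (y , n , c)))
            (#-mono (λ y → N? x y ⊎-dec covered? E y) (covered? (x ∷ E)) λ { y (inj₁ n) → here n ; y (inj₂ c) → there c })) ,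
        here (let y , n = #-witness (N? x) (<-≤-trans 0<ℓ h) in y , n , n) ∷ All.map there dom

  -- A vertex of G has degree below ℓ and gains a neighbour, so its truncated degree rises by at
  -- least 1; no other truncated degree falls.
  potential-grows : ∀ {k a b c ℓ} {N : Fin k → Fin k → Set a} {N′ : Fin k → Fin k → Set b} {G : Fin k → Set c}
    (N? : ∀ x y → Dec (N x y)) (N′? : ∀ x y → Dec (N′ x y)) (G? : ∀ x → Dec (G x)) →
    (∀ x y → N x y → N′ x y) → (∀ x → G x → # (N? x) < ℓ × ∃ λ y → N′ x y × ¬ N x y) →
    # G? + potential N? ℓ ≤ potential N′? ℓ
  potential-grows {ℓ = ℓ} {G = G} N? N′? G? mono new =
    ≤-trans (≤-reflexive (sym (∑-distrib-+ (indicator ∘ G?) (λ x → ℓ ⊓ # (N? x))))) (sum-mono λ x → pointwise x (G? x))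
    where
    pointwise : ∀ x (g : Dec (G x)) → indicator g + ℓ ⊓ # (N? x) ≤ ℓ ⊓ # (N′? x)
    pointwise x (no _) = ⊓-monoʳ-≤ ℓ (#-mono (N? x) (N′? x) (mono x))
    pointwise x (yes g) with new x g
    ... | low , y , n′ , ¬n = ⊓-glb (≤-trans (s≤s (m⊓n≤n ℓ _)) low)
      (≤-trans (s≤s (m⊓n≤n ℓ _)) (#-mono-< (N? x) (N′? x) (mono x) y n′ ¬n))

  -- Congruences modulo p and Dirichlet's theorem on simultaneous approximation.

  module Modular (p : ℕ) .{{_ : NonZero p}} where

    infix 4 _≈_ _≈?_
    -- A record instead of the bare divisibility, so that x and y can be recovered by unification.
    record _≈_ (x y : ℤ) : Set where
      constructor congruent
      field difference : + p ∣ x ℤ.- y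
    open _≈_ public

    _≈?_ : ∀ x y → Dec (x ≈ y)
    x ≈? y = map′ congruent difference (+ p ∣? x ℤ.- y)

    ≈-reflexive : ∀ {x y} → x ≡ y → x ≈ y
    ≈-reflexive {x} refl = congruent (divides (+ 0) (ℤ.+-inverseʳ x))

    ≈-refl : ∀ {x} → x ≈ x
    ≈-refl = ≈-reflexive refl

    ≈-sym : ∀ {x y} → x ≈ y → y ≈ x
    ≈-sym {x} {y} (congruent h) = congruent (subst (+ p ∣_) (solve 2 (λ x y → :- (x :- y) := y :- x) refl x y) (∣m⇒∣-m h))

    ≈-trans : ∀ {x y z} → x ≈ y → y ≈ z → x ≈ z
    ≈-trans {x} {y} {z} (congruent h) (congruent g) =
      congruent (subst (+ p ∣_) (solve 3 (λ x y z → (x :- y) :+ (y :- z) := x :- z) refl x y z) (∣m∣n⇒∣m+n h g))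

    +-cong : ∀ {x y u v} → x ≈ y → u ≈ v → x ℤ.+ u ≈ y ℤ.+ v
    +-cong {x} {y} {u} {v} (congruent h) (congruent g) = congruent (subst (+ p ∣_)
      (solve 4 (λ x y u v → (x :- y) :+ (u :- v) := (x :+ u) :- (y :+ v)) refl x y u v) (∣m∣n⇒∣m+n h g))

    neg-cong : ∀ {x y} → x ≈ y → ℤ.- x ≈ ℤ.- y
    neg-cong {x} {y} (congruent h) = congruent (subst (+ p ∣_)
      (solve 2 (λ x y → :- (x :- y) := (:- x) :- (:- y)) refl x y) (∣m⇒∣-m h))

    *-congˡ : ∀ c {x y} → x ≈ y → c ℤ.* x ≈ c ℤ.* y
    *-congˡ c {x} {y} (congruent h) = congruent (subst (+ p ∣_)
      (solve 3 (λ c x y → c :* (x :- y) := c :* x :- c :* y) refl c x y) (∣n⇒∣m*n c h))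

    residue : ℤ → ℕ
    residue x = x ℤ.%ℕ p

    residue<p : ∀ x → residue x < p
    residue<p x = ℤ.n%ℕd<d x p

    ≈residue : ∀ x → x ≈ + residue x
    ≈residue x = congruent (divides (x ℤ./ℕ p) (trans (cong (ℤ._- + residue x) (ℤ.a≡a%ℕn+[a/ℕn]*n x p))
      (solve 2 (λ r s → r :+ s :- r := s) refl (+ residue x) (x ℤ./ℕ p ℤ.* + p))))

    small-multiple : ∀ {z} → + p ∣ z → ℤ.∣ z ∣ < p → z ≡ + 0
    small-multiple {z} h l with ℤ.∣ z ∣ in eq | ∣⇒∣ᵤ h
    ... | zero | _ = ℤ.∣i∣≡0⇒i≡0 eq
    ... | suc n | d = ⊥-elim (<⇒≱ l (ℕ∣.∣⇒≤ d))

    ≈⇒≡ : ∀ {x y} → x ≈ y → ℤ.∣ x ℤ.- y ∣ < p → x ≡ y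
    ≈⇒≡ {x} {y} (congruent h) l = ℤ.i-j≡0⇒i≡j x y (small-multiple h l)

    residue-unique : ∀ {x n} → x ≈ + n → n < p → residue x ≡ n
    residue-unique {x} {n} h n<p = ℤ.+-injective (≈⇒≡ (≈-trans (≈-sym (≈residue x)) h)
      (subst (_< p) (cong ℤ.∣_∣ (sym (ℤ.[+m]-[+n]≡m⊖n (residue x) n)))
        (≤-<-trans (ℤ.∣m⊝n∣≤m⊔n (residue x) n) (⊔-lub (residue<p x) n<p))))

    -- The quotient of r N by p says in which of N intervals of length p / N the residue r lies. If
    -- the quotients agree, r N and s N differ only by their remainders.
    same-box : ∀ N r s → (r * N) / p ≡ (s * N) / p → ℤ.∣ + r ℤ.- + s ∣ * N < p
    same-box N r s h = subst (λ z → ℤ.∣ z ∣ * N < p) (sym (ℤ.[+m]-[+n]≡m⊖n r s)) (cases (≤-total r s))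
      where
      ordered : ∀ {r s} → (r * N) / p ≡ (s * N) / p → (s ∸ r) * N < p
      ordered {r} {s} h = begin-strict
        (s ∸ r) * N                          ≡⟨ *-distribʳ-∸ N s r ⟩
        s * N ∸ r * N                        ≤⟨ ∸-monoʳ-≤ (s * N) (m/n*n≤m (r * N) p) ⟩
        s * N ∸ (r * N) / p * p              ≡⟨ cong (λ c → s * N ∸ c * p) h ⟩
        s * N ∸ (s * N) / p * p              ≡⟨ cong (_∸ (s * N) / p * p) (m≡m%n+[m/n]*n (s * N) p) ⟩
        (s * N) % p + (s * N) / p * p ∸ (s * N) / p * p ≡⟨ m+n∸n≡m ((s * N) % p) ((s * N) / p * p) ⟩
        (s * N) % p                          <⟨ m%n<n (s * N) p ⟩
        p                                    ∎
        where open ≤-Reasoning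
      cases : r ≤ s ⊎ s ≤ r → ℤ.∣ r ℤ.⊖ s ∣ * N < p
      cases (inj₁ l) = subst (λ z → z * N < p) (sym (ℤ.∣⊖∣-≤ l)) (ordered {r} {s} h)
      cases (inj₂ l) = subst (λ z → z * N < p) (sym (trans (ℤ.∣m⊖n∣≡∣n⊖m∣ r s) (ℤ.∣⊖∣-≤ l))) (ordered {s} {r} (sym h))

    module _ {I : Set} (x : I → ℤ) (N : I → ℕ) (N>0 : ∀ i → NonZero (N i)) where

      box : ∀ i → ℕ → Fin (N i)
      box i s = fromℕ< (m<n*o⇒m/o<n {residue (+ s ℤ.* x i) * N i} {N i} {p}
        (subst (residue (+ s ℤ.* x i) * N i <_) (*-comm p (N i)) (*-monoˡ-< (N i) {{N>0 i}} (residue<p (+ s ℤ.* x i)))))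

      same-box⇒close : ∀ i s t → box i s ≡ box i t →
        ∃ λ w → (+ t ℤ.- + s) ℤ.* x i ≈ w × ℤ.∣ w ∣ * N i < p
      same-box⇒close i s t e = + r t ℤ.- + r s
        , ≈-trans (≈-reflexive (solve 3 (λ t s x → (t :- s) :* x := t :* x :+ :- (s :* x)) refl (+ t) (+ s) (x i)))
            (+-cong (≈residue (+ t ℤ.* x i)) (neg-cong (≈residue (+ s ℤ.* x i))))
        , same-box (N i) (r t) (r s) (trans (sym (Fin.toℕ-fromℕ< _)) (trans (cong toℕ (sym e)) (Fin.toℕ-fromℕ< _)))
        where
        r : ℕ → ℕ
        r s = residue (+ s ℤ.* x i)

      -- The tuple of boxes of all the multiples, packed into one index so that a single pigeonhole
      -- suffices.
      encode : ∀ is → ℕ → Fin (product (map N is))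
      encode [] s = zero
      encode (i ∷ is) s = combine (box i s) (encode is s)

      same-code⇒close : ∀ is s t → encode is s ≡ encode is t →
        All (λ i → ∃ λ w → (+ t ℤ.- + s) ℤ.* x i ≈ w × ℤ.∣ w ∣ * N i < p) is
      same-code⇒close [] s t _ = []
      same-code⇒close (i ∷ is) s t e with Fin.combine-injective (box i s) (encode is s) (box i t) (encode is t) e
      ... | e₁ , e₂ = same-box⇒close i s t e₁ ∷ same-code⇒close is s t e₂

      -- There are p multipliers and fewer than p codes, so two multipliers s and t share a code.
      -- Their difference is nonzero and less than p in absolute value, hence prime to p. The number
      -- of boxes may vary with i, so that some residues can be approximated more finely than
      -- others.
      dirichlet : ∀ is → product (map N is) < p →
        ∃ λ μ → ¬ + p ∣ μ × All (λ i → ∃ λ w → μ ℤ.* x i ≈ w × ℤ.∣ w ∣ * N i < p) is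
      dirichlet is big with Fin.pigeonhole big (λ s → encode is (toℕ s))
      ... | s , t , s<t , same = + toℕ t ℤ.- + toℕ s , p∤ , same-code⇒close is (toℕ s) (toℕ t) same
        where
        p∤ : ¬ + p ∣ + toℕ t ℤ.- + toℕ s
        p∤ h = <-irrefl (sym (ℤ.+-injective (ℤ.i-j≡0⇒i≡j (+ toℕ t) (+ toℕ s) (small-multiple h l)))) s<t
          where
          l : ℤ.∣ + toℕ t ℤ.- + toℕ s ∣ < p
          l = subst (_< p) (cong ℤ.∣_∣ (sym (ℤ.[+m]-[+n]≡m⊖n (toℕ t) (toℕ s))))
            (≤-<-trans (ℤ.∣m⊝n∣≤m⊔n (toℕ t) (toℕ s)) (⊔-lub (Fin.toℕ<n t) (Fin.toℕ<n s)))

  -- Dilates of a set without unique sums.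

  module Configuration
    (p : ℕ) .{{_ : NonZero p}} (pr : Prime p) (k : ℕ) (e : Fin k → ℤ)
    (e-injective : ∀ {x y} → Modular._≈_ p (e x) (e y) → x ≡ y)
    (left right : Fin k → Fin k → Fin k)
    (same-sum : ∀ a b → Modular._≈_ p (e a ℤ.+ e b) (e (left a b) ℤ.+ e (right a b)))
    (left≢ : ∀ a b → left a b ≢ a) (left≢′ : ∀ a b → left a b ≢ b)
    (right≢ : ∀ a b → right a b ≢ a) (right≢′ : ∀ a b → right a b ≢ b)
    where
    open Modular p

    cancel : ∀ {μ x y} → ¬ + p ∣ μ → μ ℤ.* x ≈ μ ℤ.* y → x ≈ y
    cancel {μ} {x} {y} p∤μ (congruent h) = [ (λ d → ⊥-elim (p∤μ (∣ᵤ⇒∣ d))) , (λ d → congruent (∣ᵤ⇒∣ d)) ]′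
      (euclidsLemma ℤ.∣ μ ∣ ℤ.∣ x ℤ.- y ∣ pr (subst (p ℕ∣.∣_) (ℤ.abs-* μ (x ℤ.- y)) (∣⇒∣ᵤ
        (subst (+ p ∣_) (solve 3 (λ m x y → m :* x :- m :* y := m :* (x :- y)) refl μ x y) h))))

    -- Abstract, because normalising these products blows up.
    abstract
      fine scale : ℕ
      fine = 16 * (2 + k)
      scale = 32 * (2 + k)

      fine≡ : fine ≡ 16 * (2 + k)
      fine≡ = refl

      scale≡ : scale ≡ 32 * (2 + k)
      scale≡ = refl

      instance
        fine-nonZero : NonZero fine
        fine-nonZero = _

    k<fine : k < fine
    k<fine = subst (k <_) (sym fine≡) (≤-trans (m≤n+m (suc k) 1) (m≤n*m (2 + k) 16))

    -- μ x lies within (s / scale) p of a multiple of p.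
    record Small (μ : ℤ) (s : ℕ) (x : ℤ) : Set where
      constructor within
      field
        value : ℤ
        value-≈ : μ ℤ.* x ≈ value
        bound : ℤ.∣ value ∣ * scale ≤ s * p
    open Small

    module _ {μ : ℤ} where
      small-cong : ∀ {s x y} → x ≈ y → Small μ s x → Small μ s y
      small-cong h (within w g l) = within w (≈-trans (*-congˡ μ (≈-sym h)) g) l

      small-mono : ∀ {s t x} → s ≤ t → Small μ s x → Small μ t x
      small-mono h (within w g l) = within w g (≤-trans l (*-monoˡ-≤ p h))

      small-+ : ∀ {s t x y} → Small μ s x → Small μ t y → Small μ (s + t) (x ℤ.+ y)
      small-+ {s} {t} {x} {y} (within u g l) (within v h m) = within (u ℤ.+ v)
        (≈-trans (≈-reflexive (ℤ.*-distribˡ-+ μ x y)) (+-cong g h))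
        (≤-trans (*-monoˡ-≤ scale (ℤ.∣i+j∣≤∣i∣+∣j∣ u v))
            (subst₂ _≤_ (sym (*-distribʳ-+ scale ℤ.∣ u ∣ ℤ.∣ v ∣)) (sym (*-distribʳ-+ p s t)) (+-mono-≤ l m)))

      small-neg : ∀ {s x} → Small μ s x → Small μ s (ℤ.- x)
      small-neg {s} {x} (within u g l) = within (ℤ.- u)
        (≈-trans (≈-reflexive (sym (ℤ.neg-distribʳ-* μ x))) (neg-cong g))
        (subst (λ z → z * scale ≤ s * p) (sym (ℤ.∣-i∣≡∣i∣ u)) l)

      small-- : ∀ {s t x y} → Small μ s x → Small μ t y → Small μ (s + t) (x ℤ.- y)
      small-- g h = small-+ g (small-neg h)

    -- Every dilated value is at most 7 p / 32 < p / 4 in absolute value, so a congruence between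
    -- two sums of two values is an equality of integers. For a with the largest value, w a + w a =
    -- w c + w d then forces w c = w a, hence c = a.
    not-all-small : Fin k → ∀ μ → ¬ + p ∣ μ → ¬ (∀ x → Small μ (7 * (2 + k)) (e x))
    not-all-small x₀ μ p∤μ small = left≢ a a (e-injective (cancel p∤μ
      (≈-trans (image c) (≈-trans (≈-reflexive wc≡wa) (≈-sym (image a))))))
      where
      w : Fin k → ℤ
      w x = value (small x)
      image : ∀ x → μ ℤ.* e x ≈ w x
      image x = value-≈ (small x)
      a c d : Fin k
      a = argmax w x₀ (allFin k)
      c = left a a
      d = right a a
      maximal : ∀ x → w x ℤ.≤ w a
      maximal x = All.lookup (f[xs]≤f[argmax] {f = w} x₀ (allFin k)) (∈-allFin x)
      sums : w a ℤ.+ w a ≈ w c ℤ.+ w d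
      sums = ≈-trans (+-cong (≈-sym (image a)) (≈-sym (image a)))
        (≈-trans (≈-reflexive (sym (ℤ.*-distribˡ-+ μ (e a) (e a))))
        (≈-trans (*-congˡ μ (same-sum a a))
        (≈-trans (≈-reflexive (ℤ.*-distribˡ-+ μ (e c) (e d))) (+-cong (image c) (image d)))))
      close : ℤ.∣ (w a ℤ.+ w a) ℤ.- (w c ℤ.+ w d) ∣ < p
      close = ≤-<-trans (≤-trans (ℤ.∣i-j∣≤∣i∣+∣j∣ (w a ℤ.+ w a) (w c ℤ.+ w d))
          (+-mono-≤ (ℤ.∣i+j∣≤∣i∣+∣j∣ (w a) (w a)) (ℤ.∣i+j∣≤∣i∣+∣j∣ (w c) (w d))))
        (*-cancelʳ-< scale ((A + A) + (C + D)) p (begin-strict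
          ((A + A) + (C + D)) * scale
            ≡⟨ N.solve 4 (λ a c d s → ((a N.:+ a) N.:+ (c N.:+ d)) N.:* s N.:= (a N.:* s N.:+ a N.:* s) N.:+ (c N.:* s N.:+ d N.:* s)) refl A C D scale ⟩
          (A * scale + A * scale) + (C * scale + D * scale)
            ≤⟨ +-mono-≤ (+-mono-≤ (bound (small a)) (bound (small a))) (+-mono-≤ (bound (small c)) (bound (small d))) ⟩
          (7 * (2 + k) * p + 7 * (2 + k) * p) + (7 * (2 + k) * p + 7 * (2 + k) * p)
            ≡⟨ N.solve 2 (λ m p → (N.con 7 N.:* m N.:* p N.:+ N.con 7 N.:* m N.:* p) N.:+ (N.con 7 N.:* m N.:* p N.:+ N.con 7 N.:* m N.:* p) N.:= p N.:* (N.con 28 N.:* m)) refl (2 + k) p ⟩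
          p * (28 * (2 + k)) <⟨ *-monoʳ-< p (subst (28 * (2 + k) <_) (sym scale≡) (*-monoˡ-< (2 + k) {28} {32} (s≤s (≤ᵇ⇒≤ 28 31 _)))) ⟩
          p * scale ∎))
        where
        open ≤-Reasoning
        A C D : ℕ
        A = ℤ.∣ w a ∣
        C = ℤ.∣ w c ∣
        D = ℤ.∣ w d ∣
      wc≡wa : w c ≡ w a
      wc≡wa = ℤ.≤-antisym (maximal c) (subst₂ ℤ._≤_
        (solve 2 (λ a d → (a :+ a) :- a := a) refl (w a) (w d))
        (solve 2 (λ c d → (c :+ d) :- d := c) refl (w c) (w d))
        (ℤ.+-mono-≤ (ℤ.≤-reflexive (≈⇒≡ sums close)) (ℤ.neg-mono-≤ (maximal d))))

    module Parameters (ℓ q : ℕ) (0<ℓ : 0 < ℓ) (k<qℓ : k < q * ℓ)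
      (large : 32 ^ (4 * q) * fine ^ (suc (ℓ * ℓ) * (ℓ * (ℓ * ℓ) + ℓ)) < p) (x₀ : Fin k)
      where

      -- `maxSteps` bounds the length of S: it leaves room for ℓ² + 1 enlargements, each by at most
      -- `coverSize` differences.
      coverSize maxSteps : ℕ
      coverSize = ℓ * (ℓ * ℓ) + ℓ
      maxSteps = suc (ℓ * ℓ) * coverSize

      private instance
        ℓ-nonZero : NonZero ℓ
        ℓ-nonZero = >-nonZero 0<ℓ
        ℓ²-nonZero : NonZero (ℓ * ℓ)
        ℓ²-nonZero = m*n≢0 ℓ ℓ

      -- Dirichlet's theorem with 32 boxes for each element of D and `fine` boxes for each residue
      -- in S brings them within p / 32 and p / `fine` of 0. In units of p / `scale` these distances
      -- are 2 + k and 2.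
      finish : (D : List (Fin k)) (S : List ℤ) → length D ≤ 4 * q → length S ≤ maxSteps →
        ¬ (∀ μ → All (Small μ (2 + k) ∘ e) D → All (Small μ 2) S → ∀ x → Small μ (7 * (2 + k)) (e x))
      finish D S D≤ S≤ conclude = conclusion (dirichlet [ e , id ]′ N (λ { (inj₁ _) → _ ; (inj₂ _) → fine-nonZero }) items size)
        where
        N : Fin k ⊎ ℤ → ℕ
        N (inj₁ _) = 32
        N (inj₂ _) = fine
        items : List (Fin k ⊎ ℤ)
        items = map inj₁ D ++ map inj₂ S
        product₂ : ∀ S → product (map N (map inj₂ S)) ≡ fine ^ length S
        product₂ [] = refl
        product₂ (_ ∷ S) = cong (fine *_) (product₂ S)
        product₁ : ∀ D → product (map N (map inj₁ D ++ map inj₂ S)) ≡ 32 ^ length D * fine ^ length S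
        product₁ [] = trans (product₂ S) (sym (*-identityˡ _))
        product₁ (_ ∷ D) = trans (cong (32 *_) (product₁ D)) (sym (*-assoc 32 (32 ^ length D) _))
        size : product (map N items) < p
        size = subst (_< p) (sym (product₁ D))
          (≤-<-trans (*-mono-≤ (^-monoʳ-≤ 32 D≤) (^-monoʳ-≤ fine S≤)) large)
        coarse-bound : ∀ w → ℤ.∣ w ∣ * 32 < p → ℤ.∣ w ∣ * scale ≤ (2 + k) * p
        coarse-bound w h = subst (λ z → ℤ.∣ w ∣ * z ≤ (2 + k) * p) (sym scale≡) (subst₂ _≤_
          (N.solve 2 (λ w m → m N.:* (w N.:* N.con 32) N.:= w N.:* (N.con 32 N.:* m)) refl ℤ.∣ w ∣ (2 + k)) refl
          (*-monoʳ-≤ (2 + k) (<⇒≤ h)))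
        fine-bound : ∀ w → ℤ.∣ w ∣ * fine < p → ℤ.∣ w ∣ * scale ≤ 2 * p
        fine-bound w h = subst (λ z → ℤ.∣ w ∣ * z ≤ 2 * p) (sym scale≡) (subst₂ _≤_
          (N.solve 2 (λ w m → N.con 2 N.:* (w N.:* (N.con 16 N.:* m)) N.:= w N.:* (N.con 32 N.:* m)) refl ℤ.∣ w ∣ (2 + k)) refl
          (*-monoʳ-≤ 2 (<⇒≤ (subst (λ z → ℤ.∣ w ∣ * z < p) fine≡ h))))
        conclusion : ¬ ∃ λ μ → ¬ + p ∣ μ × All (λ i → ∃ λ w → μ ℤ.* [ e , id ]′ i ≈ w × ℤ.∣ w ∣ * N i < p) items
        conclusion (μ , p∤μ , close) = not-all-small x₀ μ p∤μ (conclude μ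
          (All.map (λ (w , h , l) → within w h (coarse-bound w l)) (All.map⁻ (All.++⁻ˡ (map inj₁ D) close)))
          (All.map (λ (w , h , l) → within w h (fine-bound w l)) (All.map⁻ (All.++⁻ʳ (map inj₁ D) close))))

      -- The graph of the differences in S.

      Adj : List ℤ → Fin k → Fin k → Set
      Adj S x y = x ≢ y × Any (λ s → (e y ℤ.- e x ≈ s) ⊎ (e x ℤ.- e y ≈ s)) S

      adj? : ∀ S x y → Dec (Adj S x y)
      adj? S x y = ¬? (x Fin.≟ y) ×-dec Any.any? (λ s → (e y ℤ.- e x ≈? s) ⊎-dec (e x ℤ.- e y ≈? s)) S

      adj-sym : ∀ {S x y} → Adj S x y → Adj S y x
      adj-sym (x≢y , h) = x≢y ∘ sym , Any.map swap h

      adj-small : ∀ {S μ x y} → All (Small μ 2) S → Adj S x y → Small μ 2 (e y ℤ.- e x)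
      adj-small {S} {μ} {x} {y} small (_ , h) = go small h
        where
        go : ∀ {S} → All (Small μ 2) S → Any (λ s → (e y ℤ.- e x ≈ s) ⊎ (e x ℤ.- e y ≈ s)) S → Small μ 2 (e y ℤ.- e x)
        go (s ∷ _) (here (inj₁ h)) = small-cong (≈-sym h) s
        go (s ∷ _) (here (inj₂ h)) = small-cong
          (≈-trans (neg-cong (≈-sym h)) (≈-reflexive (solve 2 (λ x y → :- (x :- y) := y :- x) refl (e x) (e y)))) (small-neg s)
        go (_ ∷ ss) (there h) = go ss h

      -- Orienting the edges by a dilation; paths to top vertices.

      module Oriented (S : List ℤ) (μ : ℤ) (p∤μ : ¬ + p ∣ μ)
        (close : All (λ s → ∃ λ w → μ ℤ.* s ≈ w × ℤ.∣ w ∣ * fine < p) S) where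

        -- Being small and positive after dilation: the residue lies in (0, p / `fine`), whereas
        -- small negative values have residues near p.
        Positive : ℤ → Set
        Positive x = 0 < residue (μ ℤ.* x) × residue (μ ℤ.* x) * fine < p

        positive : ∀ {x n} → μ ℤ.* x ≈ + n → 0 < n → n * fine < p → Positive x
        positive {x} {n} h 0<n l = subst (λ r → 0 < r × r * fine < p) (sym (residue-unique h (≤-<-trans (m≤m*n n fine) l))) (0<n , l)

        Step : Fin k → Fin k → Set
        Step x y = Adj S x y × Positive (e y ℤ.- e x)

        step? : ∀ x y → Dec (Step x y)
        step? x y = adj? S x y ×-dec (0 <? residue (μ ℤ.* (e y ℤ.- e x))) ×-dec (residue (μ ℤ.* (e y ℤ.- e x)) * fine <? p)

        signed : ∀ {x y} → x ≢ y → (∃ λ w → μ ℤ.* (e y ℤ.- e x) ≈ w × ℤ.∣ w ∣ * fine < p) →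
                 Positive (e y ℤ.- e x) ⊎ Positive (e x ℤ.- e y)
        signed {x} {y} x≢y (+ zero , h , l) = ⊥-elim (x≢y (sym (e-injective (congruent (subst (+ p ∣_) (ℤ.+-identityʳ _)
          (difference (cancel p∤μ (≈-trans h (≈-reflexive (sym (ℤ.*-zeroʳ μ)))))))))))
        signed x≢y (+[1+ n ] , h , l) = inj₁ (positive h z<s l)
        signed {x} {y} x≢y (-[1+ n ] , h , l) = inj₂ (positive (≈-trans
          (≈-reflexive (solve 3 (λ m x y → m :* (x :- y) := :- (m :* (y :- x))) refl μ (e x) (e y))) (neg-cong h)) z<s l)

        adj⇒step : ∀ {x y} → Adj S x y → Step x y ⊎ Step y x
        adj⇒step {x} {y} a@(x≢y , h) = orient (signed x≢y (go close h))
          where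
          orient : Positive (e y ℤ.- e x) ⊎ Positive (e x ℤ.- e y) → Step x y ⊎ Step y x
          orient (inj₁ h) = inj₁ (a , h)
          orient (inj₂ h) = inj₂ (adj-sym {S} a , h)
          go : ∀ {S} → All (λ s → ∃ λ w → μ ℤ.* s ≈ w × ℤ.∣ w ∣ * fine < p) S →
               Any (λ s → (e y ℤ.- e x ≈ s) ⊎ (e x ℤ.- e y ≈ s)) S → ∃ λ w → μ ℤ.* (e y ℤ.- e x) ≈ w × ℤ.∣ w ∣ * fine < p
          go ((w , h , l) ∷ _) (here (inj₁ g)) = w , ≈-trans (*-congˡ μ g) h , l
          go ((w , h , l) ∷ _) (here (inj₂ g)) = ℤ.- w
            , ≈-trans (≈-reflexive (solve 3 (λ m x y → m :* (y :- x) := :- (m :* (x :- y))) refl μ (e x) (e y)))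
                (neg-cong (≈-trans (*-congˡ μ g) h))
            , subst (λ z → z * fine < p) (sym (ℤ.∣-i∣≡∣i∣ w)) l
          go (_ ∷ cs) (there h) = go cs h

        Top : Fin k → Set
        Top x = ¬ ∃ (Step x)

        top? : ∀ x → Dec (Top x)
        top? x = ¬? (Fin.any? (step? x))

        -- An edge b – d comes with an opposite edge a – c, so one of a and b would not be top.
        top-sum : ∀ {a b c d} → Top a → Top b → a ≢ c → e a ℤ.+ e b ≈ e c ℤ.+ e d → ¬ Adj S b d
        top-sum {a} {b} {c} {d} ta tb a≢c same adj@(_ , h) =
          [ (λ up → tb (d , up)) , (λ (_ , pos) → ta (c , (a≢c , transport) , subst-positive pos)) ]′ (adj⇒step adj)
          where
          moved : e b ℤ.- e d ≈ e c ℤ.- e a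
          moved = ≈-trans (≈-reflexive (solve 3 (λ a b d → b :- d := (a :+ b) :+ :- (a :+ d)) refl (e a) (e b) (e d)))
            (≈-trans (+-cong same ≈-refl) (≈-reflexive (solve 3 (λ a c d → (c :+ d) :+ :- (a :+ d) := c :- a) refl (e a) (e c) (e d))))
          moved′ : e d ℤ.- e b ≈ e a ℤ.- e c
          moved′ = ≈-trans (≈-reflexive (solve 2 (λ b d → d :- b := :- (b :- d)) refl (e b) (e d)))
            (≈-trans (neg-cong moved) (≈-reflexive (solve 2 (λ a c → :- (c :- a) := a :- c) refl (e a) (e c))))
          transport : Any (λ s → (e c ℤ.- e a ≈ s) ⊎ (e a ℤ.- e c ≈ s)) S
          transport = Any.map (λ { (inj₁ g) → inj₂ (≈-trans (≈-sym moved′) g) ; (inj₂ g) → inj₁ (≈-trans (≈-sym moved) g) }) h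
          subst-positive : Positive (e b ℤ.- e d) → Positive (e c ℤ.- e a)
          subst-positive (0<r , l) = positive (≈-trans (*-congˡ μ (≈-sym moved)) (≈residue (μ ℤ.* (e b ℤ.- e d)))) 0<r l

        data Path : ℕ → Fin k → Fin k → Set where
          stop : ∀ {x} → Path 0 x x
          _►_  : ∀ {n x y z} → Step x y → Path n y z → Path (suc n) x z

        -- The residues along the path are added as integers; each of them is at least 1 and less
        -- than p / `fine`.
        rise : ∀ {n x y} → Path n x y → ∃ λ h → μ ℤ.* (e y ℤ.- e x) ≈ + h × h * fine ≤ n * p × n ≤ h
        rise {x = x} stop = 0 , ≈-reflexive (solve 2 (λ m x → m :* (x :- x) := con (+ 0)) refl μ (e x)) , z≤n , z≤n
        rise {suc n} {x} {z} (_►_ {y = y} (_ , 0<r , r<) path) = add (rise path)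
          where
          r : ℕ
          r = residue (μ ℤ.* (e y ℤ.- e x))
          add : (∃ λ h → μ ℤ.* (e z ℤ.- e y) ≈ + h × h * fine ≤ n * p × n ≤ h) →
                ∃ λ h → μ ℤ.* (e z ℤ.- e x) ≈ + h × h * fine ≤ suc n * p × suc n ≤ h
          add (h , g , l , n≤h) = r + h
            , ≈-trans (≈-reflexive (solve 4 (λ m x y z → m :* (z :- x) := m :* (y :- x) :+ m :* (z :- y)) refl μ (e x) (e y) (e z)))
                (+-cong (≈residue (μ ℤ.* (e y ℤ.- e x))) g)
            , ≤-trans (≤-reflexive (*-distribʳ-+ fine r h)) (+-mono-≤ (<⇒≤ r<) l)
            , +-mono-≤ 0<r n≤h

        -- A closed path would have a rise h divisible by p, but 0 < n ≤ h, and h ≤ n p / `fine` < p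
        -- because n ≤ k < `fine`.
        acyclic : ∀ {n x} → 0 < n → n ≤ k → ¬ Path n x x
        acyclic {n} {x} 0<n n≤k path = refute (rise path)
          where
          refute : ¬ ∃ λ h → μ ℤ.* (e x ℤ.- e x) ≈ + h × h * fine ≤ n * p × n ≤ h
          refute (h , g , l , n≤h) = <⇒≢ (<-≤-trans 0<n n≤h)
            (trans (sym (residue-unique (≈-reflexive (solve 2 (λ m x → m :* (x :- x) := con (+ 0)) refl μ (e x))) (>-nonZero⁻¹ p)))
              (residue-unique g h<p))
            where
            h<p : h < p
            h<p = *-cancelʳ-< fine h p (≤-<-trans l (≤-<-trans (*-monoˡ-≤ p n≤k)
              (subst (k * p <_) (*-comm fine p) (*-monoˡ-< p k<fine))))

        -- Follow upward edges until none is left or n of them have been used. The walk is a total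
        -- function on the naturals, ready for the pigeonhole principle; its values beyond n are
        -- arbitrary.
        climb : ∀ n x → (∃₂ λ m y → m ≤ n × Top y × Path m x y) ⊎
                        (∃ λ (v : ℕ → Fin k) → v 0 ≡ x × (∀ i → i < n → Step (v i) (v (suc i))))
        climb zero x = inj₂ (const x , refl , λ _ ())
        climb (suc n) x = branch (Fin.any? (step? x))
          where
          extend : ∀ {y} → Step x y →
            (∃₂ λ m z → m ≤ n × Top z × Path m y z) ⊎ (∃ λ (v : ℕ → Fin k) → v 0 ≡ y × (∀ i → i < n → Step (v i) (v (suc i)))) →
            (∃₂ λ m z → m ≤ suc n × Top z × Path m x z) ⊎ (∃ λ (v : ℕ → Fin k) → v 0 ≡ x × (∀ i → i < suc n → Step (v i) (v (suc i))))
          extend up (inj₁ (m , z , m≤n , top , path)) = inj₁ (suc m , z , s≤s m≤n , top , up ► path)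
          extend up (inj₂ (v , refl , steps)) = inj₂
            ((λ { zero → x ; (suc i) → v i }) , refl , λ { zero _ → up ; (suc i) (s≤s i<n) → steps i i<n })
          branch : Dec (∃ (Step x)) → _
          branch (no top) = inj₁ (0 , x , z≤n , top , stop)
          branch (yes (y , up)) = extend up (climb n y)

        -- A walk of k steps visits k + 1 vertices, so two of them coincide, and the walk between
        -- them is a closed path of length at most k.
        no-long-walk : ¬ ∃ λ (v : ℕ → Fin k) → ∀ i → i < k → Step (v i) (v (suc i))
        no-long-walk (v , steps) = let i , j , i<j , same = Fin.pigeonhole (n<1+n k) (v ∘ toℕ) in
          repeat (toℕ i) (toℕ j) i<j (s≤s⁻¹ (Fin.toℕ<n j)) same
          where
          walk : ∀ n i → i + n ≤ k → Path n (v i) (v (i + n))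
          walk zero i _ = subst (λ j → Path 0 (v i) (v j)) (sym (+-identityʳ i)) stop
          walk (suc n) i h = subst (λ j → Path (suc n) (v i) (v j)) (sym (+-suc i n))
            (steps i (≤-trans (s≤s (m≤m+n i n)) h′) ► walk n (suc i) h′)
            where
            h′ : suc i + n ≤ k
            h′ = subst (_≤ k) (+-suc i n) h
          repeat : ∀ i j → i < j → j ≤ k → v i ≢ v j
          repeat i j i<j j≤k same = acyclic (m<n⇒0<n∸m i<j) (≤-trans (m∸n≤m j i) j≤k)
            (subst (Path (j ∸ i) (v i)) (trans (cong v i+[j∸i]≡j) (sym same))
              (walk (j ∸ i) i (subst (_≤ k) (sym i+[j∸i]≡j) j≤k)))
            where
            i+[j∸i]≡j : i + (j ∸ i) ≡ j
            i+[j∸i]≡j = m+[n∸m]≡n (<⇒≤ i<j)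

        reach-top : ∀ x → ∃₂ λ m y → m ≤ k × Top y × Path m x y
        reach-top x = [ id , (λ (v , _ , steps) → ⊥-elim (no-long-walk (v , steps))) ]′ (climb k x)

        -- Controlling all vertices through the top ones.

        path-small : ∀ {n x y ν s} → All (Small ν 2) S → Path n x y → Small ν s (e y) → Small ν (s + n * 2) (e x)
        path-small {s = s} small stop h = small-mono (≤-reflexive (sym (+-identityʳ s))) h
        path-small {suc n} {x} {z} {s = s} small (_►_ {y = y} (adj , _) path) h =
          small-cong (≈-reflexive (solve 2 (λ x y → y :- (y :- x) := x) refl (e x) (e y)))
            (small-mono (≤-reflexive (N.solve 2 (λ s n → s N.:+ n N.:* N.con 2 N.:+ N.con 2 N.:= s N.:+ (N.con 2 N.:+ n N.:* N.con 2)) refl s n))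
              (small-- (path-small small path h) (adj-small small adj)))

        -- A path of at most k edges adds at most 2 k to the allowance 5 (2 + k) + 4 of its top end,
        -- which makes 7 (2 + k). Here ν is a second dilation: μ only orients the edges, so D may
        -- depend on μ, and an edge is small under ν whichever way it points.
        settle : length S ≤ maxSteps → (D : List (Fin k)) → length D ≤ 4 * q →
          ¬ (∀ ν → All (Small ν (2 + k) ∘ e) D → All (Small ν 2) S → ∀ x → Top x → Small ν (5 * (2 + k) + 4) (e x))
        settle S≤ D D≤ tops = finish D S D≤ S≤ λ ν sD sS x → let m , y , m≤k , top , path = reach-top x in
          small-mono (≤-trans (+-monoʳ-≤ (5 * (2 + k) + 4) (*-monoˡ-≤ 2 m≤k))
              (≤-reflexive (N.solve 1 (λ k → N.con 5 N.:* (N.con 2 N.:+ k) N.:+ N.con 4 N.:+ k N.:* N.con 2 N.:= N.con 7 N.:* (N.con 2 N.:+ k)) refl k)))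
            (path-small sS path (tops ν sD sS y top))

        few : ∀ (E : List (Fin k)) → length E * ℓ ≤ k → length E ≤ q
        few E h = <⇒≤ (*-cancelʳ-< ℓ (length E) q (≤-<-trans h k<qℓ))

        Low : Fin k → Set
        Low x = Top x × # (adj? S x) < ℓ

        low? : ∀ x → Dec (Low x)
        low? x = top? x ×-dec (# (adj? S x) <? ℓ)

        -- Otherwise D could consist of the low top vertices and of a maximal family E for the
        -- remaining top vertices, at most q of each.
        few-low : length S ≤ maxSteps → ¬ # low? < q
        few-low S≤ low<q =
          let lows , |lows| , low∈ , _ = enumerate low?
              highs , _ , high∈ , high = enumerate (λ x → top? x ×-dec (ℓ ≤? # (adj? S x)))
              E , |E| , dominated = dominate (adj? S) ℓ 0<ℓ highs (All.map proj₂ high)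
          in settle S≤ (lows ++ E)
            (subst (_≤ 4 * q) (sym (List.length-++ lows))
              (≤-trans (+-mono-≤ (≤-trans (≤-reflexive |lows|) (<⇒≤ low<q)) (few E |E|)) (+-monoʳ-≤ q (m≤m+n q (q + (q + 0))))))
            λ ν sD sS b top → resolve ν (All.++⁻ˡ lows sD) (All.++⁻ʳ lows sD) sS low∈ high∈ dominated b top (# (adj? S b) <? ℓ)
          where
          resolve : ∀ {lows highs E} ν → All (Small ν (2 + k) ∘ e) lows → All (Small ν (2 + k) ∘ e) E → All (Small ν 2) S →
            (∀ x → Low x → x ∈ˡ lows) → (∀ x → Top x × ℓ ≤ # (adj? S x) → x ∈ˡ highs) →
            All (λ x → Any (λ f → ∃ λ y → Adj S x y × Adj S f y) E) highs →
            ∀ b → Top b → Dec (# (adj? S b) < ℓ) → Small ν (5 * (2 + k) + 4) (e b)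
          resolve ν sL sE sS low∈ high∈ dom b top (yes low) = small-mono
            (≤-trans (m≤n*m (2 + k) 5) (m≤m+n (5 * (2 + k)) 4)) (All.lookup sL (low∈ b (top , low)))
          resolve ν sL sE sS low∈ high∈ dom b top (no high) =
            -- The vertex b shares a neighbour y with some f in E, so b is reached from f by two
            -- edges, at a cost of 2 + 2.
            let sf , y , by , fy = All.lookupAny sE (All.lookup dom (high∈ b (top , ≮⇒≥ high))) in
            small-cong (≈-reflexive (solve 3 (λ b y f → f :+ (y :- f) :- (y :- b) := b) refl (e b) (e y) (e _)))
              (small-mono (≤-trans (≤-reflexive (+-assoc (2 + k) 2 2)) (+-monoˡ-≤ 4 (m≤n*m (2 + k) 5)))
                (small-- (small-+ sf (adj-small sS fy)) (adj-small sS by)))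

        -- The case of q top vertices of degree below ℓ.

        module Sparse (S≤ : length S ≤ maxSteps) (g : Fin k → Bool) (g-low : ∀ b → T (g b) → Low b) (#g : # (λ b → T? (g b)) ≡ q)
          (grow : ∀ S′ → length S′ ≤ coverSize + length S → ¬ q + potential (adj? S) ℓ ≤ potential (adj? S′) ℓ) where

          -- If u in U is one summand of the second representation c + d of a + b, then the other
          -- one differs from b by a - u, a new element of S. So b gains a neighbour, which by
          -- `top-sum` it did not have before. This happens for all q chosen b, contrary to `grow`.
          cover⇒⊥ : ∀ a U → Top a → length U ≤ coverSize → ¬ (∀ b → T (g b) → left a b ∈ˡ U ⊎ right a b ∈ˡ U)
          cover⇒⊥ a U top U≤ cover = grow S′
            (≤-trans (≤-reflexive (trans (List.length-++ differences) (cong (_+ length S) (List.length-map _ U)))) (+-monoˡ-≤ (length S) U≤))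
            (subst (λ n → n + potential (adj? S) ℓ ≤ potential (adj? S′) ℓ) #g
              (potential-grows (adj? S) (adj? S′) (λ b → T? (g b)) (λ x y (x≢y , h) → x≢y , Any.++⁺ʳ differences h)
                λ b gb → proj₂ (g-low b gb) , new b gb (cover b gb)))
            where
            differences S′ : List ℤ
            differences = map (λ u → e a ℤ.- e u) U
            S′ = differences ++ S
            near : ∀ {b y u} → b ≢ y → u ∈ˡ U → e a ℤ.+ e b ≈ e u ℤ.+ e y → Adj S′ b y
            near {b} {y} {u} b≢y u∈U same = b≢y , Any.++⁺ˡ (lose (∈-map⁺ _ u∈U) (inj₁
              (≈-trans (≈-reflexive (solve 3 (λ b y u → y :- b := (u :+ y) :+ :- (u :+ b)) refl (e b) (e y) (e u)))
              (≈-trans (+-cong (≈-sym same) ≈-refl)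
                (≈-reflexive (solve 3 (λ a b u → (a :+ b) :+ :- (u :+ b) := a :- u) refl (e a) (e b) (e u)))))))
            new : ∀ b → T (g b) → left a b ∈ˡ U ⊎ right a b ∈ˡ U → ∃ λ y → Adj S′ b y × ¬ Adj S b y
            new b gb (inj₁ u) = right a b , near (right≢′ a b ∘ sym) u (same-sum a b)
              , top-sum top (proj₁ (g-low b gb)) (left≢ a b ∘ sym) (same-sum a b)
            new b gb (inj₂ u) = left a b , near (left≢′ a b ∘ sym) u same′
              , top-sum top (proj₁ (g-low b gb)) (right≢ a b ∘ sym) same′
              where
              same′ : e a ℤ.+ e b ≈ e (right a b) ℤ.+ e (left a b)
              same′ = ≈-trans (same-sum a b) (≈-reflexive (ℤ.+-comm (e (left a b)) (e (right a b))))

          -- The vertices d with a = c + d - b for a chosen b and some c in C.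
          Nb : List (Fin k) → Fin k → Fin k → Set
          Nb C a y = ∃ λ b → T (g b) × left a b ∈ˡ C × right a b ≡ y

          nb? : ∀ C a y → Dec (Nb C a y)
          nb? C a y = Fin.any? λ b → T? (g b) ×-dec Any.any? (left a b Fin.≟_) C ×-dec (right a b Fin.≟ y)

          Unsat : List (Fin k) → Fin k → Set
          Unsat C a = Top a × # (nb? C a) < ℓ

          unsat? : ∀ C a → Dec (Unsat C a)
          unsat? C a = top? a ×-dec (# (nb? C a) <? ℓ)

          -- Vertices whose addition to C enlarges Nb C a.
          Fresh : List (Fin k) → Fin k → Fin k → Set
          Fresh C a c = ∃ λ b → T (g b) × left a b ≡ c × ¬ Nb C a (right a b)

          fresh? : ∀ C a c → Dec (Fresh C a c)
          fresh? C a c = Fin.any? λ b → T? (g b) ×-dec (left a b Fin.≟ c) ×-dec ¬? (nb? C a (right a b))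

          -- Otherwise D could consist of four lists of at most q elements: the chosen b, C, the
          -- unsaturated a, and a maximal family E. If a and f in E share a partner y, then a + b =
          -- c + y and f + b′ = c′ + y give a = f + c - b - c′ + b′, five summands from D.
          few-unsat : ∀ C → length C ≤ q → ¬ # (unsat? C) < q
          few-unsat C C≤ unsat<q =
            let B , |B| , B∈ , _ = enumerate (λ b → T? (g b))
                W , |W| , W∈ , _ = enumerate (unsat? C)
                highs , _ , high∈ , high = enumerate (λ a → top? a ×-dec (ℓ ≤? # (nb? C a)))
                E , |E| , dominated = dominate (nb? C) ℓ 0<ℓ highs (All.map proj₂ high)
            in settle S≤ (B ++ C ++ W ++ E)
              (≤-trans (≤-reflexive (trans (List.length-++ B) (cong (λ n → length B + n) (trans (List.length-++ C) (cong (λ n → length C + n) (List.length-++ W))))))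
                (+-mono-≤ (≤-reflexive (trans |B| #g)) (+-mono-≤ C≤ (+-mono-≤ (≤-trans (≤-reflexive |W|) (<⇒≤ unsat<q)) (≤-trans (few E |E|) (m≤m+n q 0))))))
              λ ν sD sS a top → resolve (λ {b} gb → All.lookup (All.++⁻ˡ B sD) (B∈ b gb))
                (All.++⁻ˡ C (All.++⁻ʳ B sD)) (All.++⁻ˡ W (All.++⁻ʳ C (All.++⁻ʳ B sD))) (All.++⁻ʳ W (All.++⁻ʳ C (All.++⁻ʳ B sD)))
                W∈ high∈ dominated a top (# (nb? C a) <? ℓ)
            where
            resolve : ∀ {W highs E ν} → (∀ {b} → T (g b) → Small ν (2 + k) (e b)) →
              All (Small ν (2 + k) ∘ e) C → All (Small ν (2 + k) ∘ e) W → All (Small ν (2 + k) ∘ e) E →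
              (∀ a → Unsat C a → a ∈ˡ W) → (∀ a → Top a × ℓ ≤ # (nb? C a) → a ∈ˡ highs) →
              All (λ a → Any (λ f → ∃ λ y → Nb C a y × Nb C f y) E) highs →
              ∀ a → Top a → Dec (# (nb? C a) < ℓ) → Small ν (5 * (2 + k) + 4) (e a)
            resolve sB sC sW sE W∈ high∈ dom a top (yes low) = small-mono
              (≤-trans (m≤n*m (2 + k) 5) (m≤m+n (5 * (2 + k)) 4)) (All.lookup sW (W∈ a (top , low)))
            resolve sB sC sW sE W∈ high∈ dom a top (no high) =
              let sf , y , (b , gb , l , r) , (b′ , gb′ , l′ , r′) = All.lookupAny sE (All.lookup dom (high∈ a (top , ≮⇒≥ high)))
              in small-cong (via _ y b b′ r r′)
                (small-mono (≤-trans (≤-reflexive (N.solve 1 (λ m → m N.:+ m N.:+ m N.:+ m N.:+ m N.:= N.con 5 N.:* m) refl (2 + k))) (m≤m+n (5 * (2 + k)) 4))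
                  (small-+ (small-- (small-- (small-+ sf (All.lookup sC l)) (sB gb)) (All.lookup sC l′)) (sB gb′)))
              where
              via : ∀ f y b b′ → right a b ≡ y → right f b′ ≡ y →
                e f ℤ.+ e (left a b) ℤ.- e b ℤ.- e (left f b′) ℤ.+ e b′ ≈ e a
              via f y b b′ r r′ = congruent (subst (+ p ∣_)
                (trans (cong₂ (λ y y′ → ((e f ℤ.+ e b′) ℤ.- (e c′ ℤ.+ e y′)) ℤ.- ((e a ℤ.+ e b) ℤ.- (e c ℤ.+ e y))) r r′)
                  (solve 7 (λ f b′ c′ y a b c → ((f :+ b′) :- (c′ :+ y)) :- ((a :+ b) :- (c :+ y)) := (f :+ c :- b :- c′ :+ b′) :- a) refl
                    (e f) (e b′) (e c′) (e y) (e a) (e b) (e c)))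
                (∣m∣n⇒∣m+n (difference (same-sum f b′)) (∣m⇒∣-m (difference (same-sum a b)))))
                where
                c c′ : Fin k
                c = left a b
                c′ = left f b′

          -- For each chosen b, either `right a b` is already in `Nb C a` or `left a b` is fresh.
          -- With fewer than ℓ³ fresh vertices, these two sets together would meet all pairs of a
          -- and have at most `coverSize` elements.
          cover : ∀ C a → Unsat C a → ¬ # (fresh? C a) < ℓ * (ℓ * ℓ)
          cover C a (top , low) small =
            let X , |X| , X∈ , _ = enumerate (fresh? C a)
                Y , |Y| , Y∈ , _ = enumerate (nb? C a)
            in cover⇒⊥ a (X ++ Y) top
              (≤-trans (≤-reflexive (List.length-++ X)) (+-mono-≤ (≤-trans (≤-reflexive |X|) (<⇒≤ small)) (≤-trans (≤-reflexive |Y|) (<⇒≤ low))))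
              λ b gb → covered X Y X∈ Y∈ b gb (nb? C a (right a b))
            where
            covered : ∀ X Y → (∀ x → Fresh C a x → x ∈ˡ X) → (∀ y → Nb C a y → y ∈ˡ Y) →
              ∀ b → T (g b) → Dec (Nb C a (right a b)) → left a b ∈ˡ X ++ Y ⊎ right a b ∈ˡ X ++ Y
            covered X Y X∈ Y∈ b gb (yes n) = inj₂ (∈-++⁺ʳ X (Y∈ (right a b) n))
            covered X Y X∈ Y∈ b gb (no ¬n) = inj₁ (∈-++⁺ˡ (X∈ (left a b) (b , gb , refl , ¬n)))

          -- While at least q vertices are unsaturated, some c is fresh for more than ℓ² of them,
          -- and adding it to C raises the potential of `Nb` by at least ℓ². The inequality in the
          -- hypothesis is preserved, and at fuel 0 it contradicts the bound k ℓ on the potential.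
          greedy : ∀ fuel C → length C + fuel ≤ q → ¬ k * ℓ < fuel * (ℓ * ℓ) + potential (nb? C) ℓ
          greedy zero C C≤ big = <⇒≱ big (potential≤ (nb? C) ℓ)
          greedy (suc fuel) C C≤ big = few-unsat C (≤-trans (m≤m+n (length C) (suc fuel)) C≤) (≰⇒> λ q≤ → extend (popular q≤))
            where
            popular : q ≤ # (unsat? C) → ∃ λ c → ℓ * ℓ < # (λ a → unsat? C a ×-dec fresh? C a c)
            popular q≤ = double-count (unsat? C) (fresh? C) {ℓ * (ℓ * ℓ)} (λ a u → ≮⇒≥ (cover C a u))
              -- At least q unsaturated vertices with ℓ³ fresh ones each make q ℓ³ > k ℓ² pairs.
              (<-≤-trans (*-monoˡ-< (ℓ * ℓ) k<qℓ) (≤-trans (≤-reflexive (*-assoc q ℓ (ℓ * ℓ))) (*-monoˡ-≤ (ℓ * (ℓ * ℓ)) q≤)))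
            extend : ¬ ∃ λ c → ℓ * ℓ < # (λ a → unsat? C a ×-dec fresh? C a c)
            extend (c , many) = greedy fuel (c ∷ C) (subst (_≤ q) (+-suc (length C) fuel) C≤) (<-≤-trans big (begin
              ℓ * ℓ + fuel * (ℓ * ℓ) + potential (nb? C) ℓ   ≡⟨ N.solve 3 (λ a b c → a N.:+ b N.:+ c N.:= b N.:+ (a N.:+ c)) refl (ℓ * ℓ) (fuel * (ℓ * ℓ)) (potential (nb? C) ℓ) ⟩
              fuel * (ℓ * ℓ) + (ℓ * ℓ + potential (nb? C) ℓ) ≤⟨ +-monoʳ-≤ (fuel * (ℓ * ℓ)) (≤-trans (+-monoˡ-≤ (potential (nb? C) ℓ) (<⇒≤ many))
                (potential-grows (nb? C) (nb? (c ∷ C)) (λ a → unsat? C a ×-dec fresh? C a c) (λ a y (b , gb , l , r) → b , gb , there l , r)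
                  λ a ((top , low) , b , gb , l≡c , fresh) → low , right a b , (b , gb , here l≡c , refl) , fresh)) ⟩
              fuel * (ℓ * ℓ) + potential (nb? (c ∷ C)) ℓ     ∎))
              where open ≤-Reasoning

          contradictory : ⊥
          contradictory = greedy q [] ≤-refl (<-≤-trans (*-monoˡ-< ℓ k<qℓ)
            (≤-trans (≤-reflexive (*-assoc q ℓ ℓ)) (m≤m+n (q * (ℓ * ℓ)) _)))

        -- Enlarging S until the potential overflows.

        grow-or-finish : length S ≤ maxSteps →
          ¬ (∀ S′ → length S′ ≤ coverSize + length S → ¬ q + potential (adj? S) ℓ ≤ potential (adj? S′) ℓ)
        grow-or-finish S≤ grow = few-low S≤ (≰⇒> λ q≤ →
          let g , g-low , #g = subset-of-size low? q q≤ in Sparse.contradictory S≤ g g-low #g grow)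

      -- Each round adds at most `coverSize` differences and raises the potential of the graph by at
      -- least q, so the strict inequality persists until fuel 0, where it exceeds the maximum k ℓ.
      stage : ∀ fuel S → length S + fuel * coverSize ≤ maxSteps → ¬ k * ℓ < fuel * q + potential (adj? S) ℓ
      stage zero S S≤ big = <⇒≱ big (potential≤ (adj? S) ℓ)
      -- Only S has to be approximated for the orientation; D is chosen afterwards.
      stage (suc fuel) S S≤ big = orient (dirichlet id (const fine) (const fine-nonZero) S (≤-<-trans size large))
        where
        |S|≤ : length S ≤ maxSteps
        |S|≤ = ≤-trans (m≤m+n (length S) _) S≤
        product-const : ∀ S → product (map (const fine) S) ≡ fine ^ length S
        product-const [] = refl
        product-const (_ ∷ S) = cong (fine *_) (product-const S)
        size : product (map (const fine) S) ≤ 32 ^ (4 * q) * fine ^ maxSteps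
        size = ≤-trans (≤-reflexive (product-const S)) (≤-trans (^-monoʳ-≤ fine |S|≤)
          (m≤n*m (fine ^ maxSteps) (32 ^ (4 * q)) {{m^n≢0 32 (4 * q)}}))
        orient : ¬ ∃ λ μ → ¬ + p ∣ μ × All (λ s → ∃ λ w → μ ℤ.* s ≈ w × ℤ.∣ w ∣ * fine < p) S
        orient (μ , p∤μ , close) = Oriented.grow-or-finish S μ p∤μ close |S|≤ λ S′ S′≤ grown → stage fuel S′
          (≤-trans (+-monoˡ-≤ (fuel * coverSize) S′≤) (≤-trans (≤-reflexive
            (N.solve 3 (λ c s f → (c N.:+ s) N.:+ f N.:= s N.:+ (c N.:+ f)) refl coverSize (length S) (fuel * coverSize))) S≤))
          (<-≤-trans big (≤-trans (≤-reflexive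
            (N.solve 3 (λ q f x → q N.:+ f N.:+ x N.:= f N.:+ (q N.:+ x)) refl q (fuel * q) (potential (adj? S) ℓ)))
            (+-monoʳ-≤ (fuel * q) grown)))

      too-large : ⊥
      too-large = stage (suc (ℓ * ℓ)) [] ≤-refl (begin-strict
        k * ℓ                  <⟨ *-monoˡ-< ℓ k<qℓ ⟩
        q * ℓ * ℓ              ≡⟨ N.solve 2 (λ q l → q N.:* l N.:* l N.:= l N.:* l N.:* q) refl q ℓ ⟩
        ℓ * ℓ * q              ≤⟨ m≤n+m (ℓ * ℓ * q) q ⟩
        suc (ℓ * ℓ) * q        ≤⟨ m≤m+n (suc (ℓ * ℓ) * q) _ ⟩
        suc (ℓ * ℓ) * q + potential (adj? []) ℓ ∎)
        where open ≤-Reasoning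

  -- From subsets of the integers modulo p to configurations.

  element : ∀ {n} (A : Subset n) → Fin ∣ A ∣ → Fin n
  element (inside ∷ A) zero = zero
  element (inside ∷ A) (suc i) = suc (element A i)
  element (outside ∷ A) i = suc (element A i)

  element-injective : ∀ {n} (A : Subset n) {i j} → element A i ≡ element A j → i ≡ j
  element-injective (inside ∷ A) {zero} {zero} _ = refl
  element-injective (inside ∷ A) {suc i} {suc j} h = cong suc (element-injective A (Fin.suc-injective h))
  element-injective (outside ∷ A) h = element-injective A (Fin.suc-injective h)

  element-∈ : ∀ {n} (A : Subset n) i → element A i ∈ A
  element-∈ (inside ∷ A) zero = here
  element-∈ (inside ∷ A) (suc i) = there (element-∈ A i)
  element-∈ (outside ∷ A) i = there (element-∈ A i)

  position : ∀ {n} {A : Subset n} {x} → x ∈ A → ∃ λ i → element A i ≡ x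
  position {A = inside ∷ A} here = zero , refl
  position {A = inside ∷ A} (there h) = let i , eq = position h in suc i , cong suc eq
  position {A = outside ∷ A} (there h) = let i , eq = position h in i , cong suc eq

  module _ (p : ℕ) .{{_ : NonZero p}} (pr : Prime p) (A : Subset p) (nus : NoUniqueSum (ℤ/ p) (_∈ A)) where
    open Modular p

    private
      k : ℕ
      k = ∣ A ∣

      e : Fin k → ℤ
      e i = + toℕ (element A i)

      e-injective : ∀ {x y} → e x ≈ e y → x ≡ y
      e-injective {x} {y} h = element-injective A (Fin.toℕ-injective (trans
        (sym (residue-unique ≈-refl (Fin.toℕ<n (element A x)))) (residue-unique h (Fin.toℕ<n (element A y)))))

      cancelˡ : ∀ {a b c d} → e a ℤ.+ e b ≈ e c ℤ.+ e d → a ≡ c → b ≡ d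
      cancelˡ {a} {b} {c} {d} h refl = e-injective (congruent (subst (+ p ∣_)
        (solve 3 (λ a b d → (a :+ b) :- (a :+ d) := b :- d) refl (e a) (e b) (e d)) (difference h)))

      ≈-+-comm : ∀ {x a b} → x ≈ e a ℤ.+ e b → x ≈ e b ℤ.+ e a
      ≈-+-comm {_} {a} {b} h = ≈-trans h (≈-reflexive (ℤ.+-comm (e a) (e b)))

      other : ∀ a b → ∃₂ λ c d → e a ℤ.+ e b ≈ e c ℤ.+ e d × ¬ (a ≡ c × b ≡ d) × ¬ (a ≡ d × b ≡ c)
      other a b = convert (nus (element A a) (element A b) (element-∈ A a) (element-∈ A b))
        where
        sum-≈ : ∀ {x y z w : Fin p} → (toℕ x + toℕ y) mod p ≡ (toℕ z + toℕ w) mod p → + toℕ x ℤ.+ + toℕ y ≈ + toℕ z ℤ.+ + toℕ w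
        sum-≈ {x} {y} {z} {w} h = ≈-trans (≈residue (+ (toℕ x + toℕ y))) (≈-trans
          (≈-reflexive (cong +_ (trans (sym (Fin.toℕ-fromℕ< _)) (trans (cong toℕ h) (Fin.toℕ-fromℕ< _)))))
          (≈-sym (≈residue (+ (toℕ z + toℕ w)))))
        convert : _ → ∃₂ λ c d → e a ℤ.+ e b ≈ e c ℤ.+ e d × ¬ (a ≡ c × b ≡ d) × ¬ (a ≡ d × b ≡ c)
        convert (x , y , x∈ , y∈ , same , distinct) = locate (position x∈) (position y∈)
          where
          locate : (∃ λ c → element A c ≡ x) → (∃ λ d → element A d ≡ y) → _
          locate (c , refl) (d , refl) = c , d , sum-≈ {element A a} {element A b} {element A c} {element A d} same
            , (λ (h , g) → distinct (inj₁ (cong (element A) h , cong (element A) g)))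
            , (λ (h , g) → distinct (inj₂ (cong (element A) h , cong (element A) g)))

      left right : Fin k → Fin k → Fin k
      left a b = proj₁ (other a b)
      right a b = proj₁ (proj₂ (other a b))

      same-sum : ∀ a b → e a ℤ.+ e b ≈ e (left a b) ℤ.+ e (right a b)
      same-sum a b = proj₁ (proj₂ (proj₂ (other a b)))

      not-same : ∀ a b → ¬ (a ≡ left a b × b ≡ right a b)
      not-same a b = proj₁ (proj₂ (proj₂ (proj₂ (other a b))))

      not-swapped : ∀ a b → ¬ (a ≡ right a b × b ≡ left a b)
      not-swapped a b = proj₂ (proj₂ (proj₂ (proj₂ (other a b))))

      swapped-sum : ∀ a b → e a ℤ.+ e b ≈ e (right a b) ℤ.+ e (left a b)
      swapped-sum a b = ≈-+-comm {a = left a b} {right a b} (same-sum a b)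

      flip-sum : ∀ {a b y} → e a ℤ.+ e b ≈ y → e b ℤ.+ e a ≈ y
      flip-sum {a} {b} = ≈-trans (≈-reflexive (ℤ.+-comm (e b) (e a)))

    module Bound = Configuration p pr k e e-injective left right same-sum
      -- If one summand of the second representation equals a or b, cancellation makes the other
      -- summand agree as well, so the representation would not be new.
      (λ a b h → not-same a b (sym h , cancelˡ (same-sum a b) (sym h)))
      (λ a b h → not-swapped a b (cancelˡ (flip-sum {a} {b} (same-sum a b)) (sym h) , sym h))
      (λ a b h → not-swapped a b (sym h , cancelˡ (swapped-sum a b) (sym h)))
      (λ a b h → not-same a b (cancelˡ (flip-sum {a} {b} (swapped-sum a b)) (sym h) , sym h))

    prime≤ : ∀ ℓ q → 0 < ℓ → k < q * ℓ → 0 < k →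
      p ≤ 32 ^ (4 * q) * (16 * (2 + k)) ^ (suc (ℓ * ℓ) * (ℓ * (ℓ * ℓ) + ℓ))
    prime≤ ℓ q 0<ℓ k<qℓ 0<k = ≮⇒≥ λ large → Bound.Parameters.too-large ℓ q 0<ℓ k<qℓ
      (subst (λ f → 32 ^ (4 * q) * f ^ (suc (ℓ * ℓ) * (ℓ * (ℓ * ℓ) + ℓ)) < p) (sym Bound.fine≡) large) (fromℕ< 0<k)

  -- Elementary inequalities for powers.

  binary-log : ∀ n → 0 < n → ∃ λ b → 2 ^ b ≤ n × n < 2 ^ suc b
  binary-log 1 _ = 0 , ≤-refl , s≤s (s≤s z≤n)
  binary-log (suc n@(suc _)) _ with binary-log n z<s
  ... | b , lo , hi with suc n <? 2 ^ suc b
  ...   | yes l = b , ≤-trans lo (n≤1+n n) , l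
  ...   | no g = suc b , ≮⇒≥ g , ≤-<-trans hi (^-monoʳ-< 2 (s≤s (s≤s z≤n)) (n<1+n (suc b)))

  ^-cancelʳ-≤₂ : ∀ {m n} → 2 ^ m ≤ 2 ^ n → m ≤ n
  ^-cancelʳ-≤₂ h = ≮⇒≥ λ l → <⇒≱ (^-monoʳ-< 2 (s≤s (s≤s z≤n)) l) h

  n<2^n : ∀ n → n < 2 ^ n
  n<2^n zero = z<s
  n<2^n (suc n) = ≤-trans (+-mono-≤ (≤-trans (s≤s z≤n) (n<2^n n)) (n<2^n n)) (≤-reflexive (cong (λ z → 2 ^ n + z) (sym (+-identityʳ (2 ^ n)))))

  2+n≤2^n : ∀ n → 2 ≤ n → 2 + n ≤ 2 ^ n
  2+n≤2^n 1 (s≤s ())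
  2+n≤2^n 2 _ = ≤-refl
  2+n≤2^n (suc n@(suc (suc _))) _ = ≤-trans (+-mono-≤ (≤-trans (s≤s z≤n) (n<2^n n)) (2+n≤2^n n (s≤s (s≤s z≤n))))
    (≤-reflexive (cong (λ z → 2 ^ n + z) (sym (+-identityʳ (2 ^ n)))))

  power≤ : ∀ {d z e} c → d ≤ 2 ^ z → z * c ≤ e → d ^ c ≤ 2 ^ e
  power≤ {d} {z} {e} c d≤ zc≤e = ≤-trans (^-monoˡ-≤ c d≤) (≤-trans (≤-reflexive (^-*-assoc 2 z c)) (^-monoʳ-≤ 2 zc≤e))

  -- With x the quotient of d by 8, d ≤ 8 (x + 1) ≤ 2^(x + 3), and 7 (x + 3) + 1 ≤ 8 x ≤ d because
  -- 22 ≤ x.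
  seventh-power≤ : ∀ d → 256 ≤ d → d ^ 7 ≤ 2 ^ (d ∸ 1)
  seventh-power≤ d 256≤d = bound (d / 8) (/-monoˡ-≤ 8 256≤d) (m/n*n≤m d 8)
    (≤-trans (≤-reflexive (m≡m%n+[m/n]*n d 8)) (+-monoˡ-≤ (d / 8 * 8) (<⇒≤ (m%n<n d 8))))
    where
    bound : ∀ x → 32 ≤ x → x * 8 ≤ d → d ≤ suc x * 8 → d ^ 7 ≤ 2 ^ (d ∸ 1)
    bound x 32≤x lo hi = power≤ {z = 3 + x} 7
      (≤-trans hi (≤-trans (*-monoˡ-≤ 8 (n<2^n x)) (≤-reflexive (trans (*-comm (2 ^ x) (2 ^ 3)) (sym (^-distribˡ-+-* 2 3 x))))))
      (∸-monoˡ-≤ {suc ((3 + x) * 7)} 1 (≤-trans (+-monoˡ-≤ (x * 7) (≤-trans (≤ᵇ⇒≤ 22 32 _) 32≤x))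
        (≤-trans (≤-reflexive (sym (*-suc x 7))) lo)))

  -- Raising every term to the top degree turns the left side into 21 D^7 + 6 · 2 · 2 D^7.
  polynomial≤ : ∀ D → 0 < D → 21 * D + (4 + (D + D)) * (suc (D * D) * (D * (D * D) + D)) * D ≤ 45 * D ^ 7
  polynomial≤ D 0<D = begin
    21 * D + (4 + (D + D)) * (suc (D * D) * (D * (D * D) + D)) * D
      ≤⟨ +-mono-≤ (*-monoʳ-≤ 21 (m≤m*n D (D ^ 6) {{m^n≢0 D 6}})) (*-monoˡ-≤ D (*-mono-≤ (+-monoˡ-≤ (D + D) (*-monoʳ-≤ 4 0<D))
           (*-mono-≤ (+-monoˡ-≤ (D * D) {1} {D * D} (*-mono-≤ 0<D 0<D)) (+-monoʳ-≤ (D * (D * D)) (m≤m*n D (D * D) {{m*n≢0 D D}}))))) ⟩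
    21 * D ^ 7 + (4 * D + (D + D)) * ((D * D + D * D) * (D * (D * D) + D * (D * D))) * D
      ≡⟨ N.solve 1 (λ D → N.con 21 N.:* D N.:^ 7 N.:+ (N.con 4 N.:* D N.:+ (D N.:+ D)) N.:* ((D N.:* D N.:+ D N.:* D) N.:* (D N.:* (D N.:* D) N.:+ D N.:* (D N.:* D))) N.:* D N.:= N.con 45 N.:* D N.:^ 7) refl D ⟩
    45 * D ^ 7 ∎
    where
    open ≤-Reasoning
    instance
      _ = >-nonZero 0<D

  -- The choice of ℓ and q, with n + 1 and D in the roles of log p and log log p.

  module _ {p k n D K : ℕ} (2≤k : 2 ≤ k)
    (prime≤ : ∀ ℓ q → 0 < ℓ → k < q * ℓ → p ≤ 32 ^ (4 * q) * (16 * (2 + k)) ^ (suc (ℓ * ℓ) * (ℓ * (ℓ * ℓ) + ℓ)))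
    (2^n≤p : 2 ^ n ≤ p) (0<D : 0 < D) (2^[D-1]≤n : 2 ^ (D ∸ 1) ≤ suc n) (n<2^D : suc n < 2 ^ D) (K-large : 256 * 43 ≤ K) where

    -- The exponents of 2 in `prime≤`, with 32 = 2^5 and 16 (2 + k) ≤ 2^(4 + h).
    n≤ : ∀ ℓ q h → 0 < ℓ → k < q * ℓ → 2 + k ≤ 2 ^ h → n ≤ 20 * q + (4 + h) * (suc (ℓ * ℓ) * (ℓ * (ℓ * ℓ) + ℓ))
    n≤ ℓ q h 0<ℓ k<qℓ 2+k≤ = ^-cancelʳ-≤₂ (begin
      2 ^ n                                        ≤⟨ 2^n≤p ⟩
      p                                            ≤⟨ prime≤ ℓ q 0<ℓ k<qℓ ⟩
      (2 ^ 5) ^ (4 * q) * (2 ^ 4 * (2 + k)) ^ E    ≤⟨ *-monoʳ-≤ ((2 ^ 5) ^ (4 * q)) (^-monoˡ-≤ E (*-monoʳ-≤ (2 ^ 4) 2+k≤)) ⟩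
      (2 ^ 5) ^ (4 * q) * (2 ^ 4 * 2 ^ h) ^ E      ≡⟨ cong₂ _*_ (^-*-assoc 2 5 (4 * q)) (cong (_^ E) (sym (^-distribˡ-+-* 2 4 h))) ⟩
      2 ^ (5 * (4 * q)) * (2 ^ (4 + h)) ^ E        ≡⟨ cong₂ _*_ (cong (2 ^_) (sym (*-assoc 5 4 q))) (^-*-assoc 2 (4 + h) E) ⟩
      2 ^ (20 * q) * 2 ^ ((4 + h) * E)             ≡⟨ ^-distribˡ-+-* 2 (20 * q) ((4 + h) * E) ⟨
      2 ^ (20 * q + (4 + h) * E)                   ∎)
      where
      open ≤-Reasoning
      E : ℕ
      E = suc (ℓ * ℓ) * (ℓ * (ℓ * ℓ) + ℓ)

    -- The choice ℓ = 1, q = k + 1 and the crude h = k already give a bound linear in k. It settles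
    -- bounded D and later absorbs the power of D.
    suc-n≤43k : suc n ≤ 43 * k
    suc-n≤43k = begin
      suc n                               ≤⟨ s≤s (n≤ 1 (suc k) k z<s (s≤s (≤-reflexive (sym (*-identityʳ k)))) (2+n≤2^n k 2≤k)) ⟩
      suc (20 * suc k + (4 + k) * 4)      ≡⟨ N.solve 1 (λ k → N.con 1 N.:+ (N.con 20 N.:* (N.con 1 N.:+ k) N.:+ (N.con 4 N.:+ k) N.:* N.con 4) N.:= N.con 37 N.:+ N.con 24 N.:* k) refl k ⟩
      37 + 24 * k                         ≤⟨ +-monoˡ-≤ (24 * k) (≤-trans (≤ᵇ⇒≤ 37 38 _) (*-monoʳ-≤ 19 2≤k)) ⟩
      19 * k + 24 * k                     ≡⟨ *-distribʳ-+ k 19 24 ⟨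
      43 * k                              ∎
      where open ≤-Reasoning

    -- Take ℓ = D, q = k / D + 1 and h = 2 D; the last is allowed because k < (n + 1) D. The main
    -- term is 20 k, and the error 45 D^7 is at most 45 (n + 1), which is again linear in k.
    large-case : 256 ≤ D → k < suc n * D → suc n * D ≤ K * k
    large-case 256≤D k<ND = begin
      suc n * D                                    ≤⟨ *-monoˡ-≤ D (s≤s (n≤ D (suc (k / D)) (D + D) 0<D k<qD 2+k≤)) ⟩
      suc (20 * suc (k / D) + (4 + (D + D)) * (suc (D * D) * (D * (D * D) + D))) * D
        ≡⟨ N.solve 4 (λ x D a b → (N.con 1 N.:+ (N.con 20 N.:* (N.con 1 N.:+ x) N.:+ a N.:* b)) N.:* D
             N.:= N.con 20 N.:* (x N.:* D) N.:+ (N.con 21 N.:* D N.:+ a N.:* b N.:* D)) refl (k / D) D (4 + (D + D)) (suc (D * D) * (D * (D * D) + D)) ⟩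
      20 * (k / D * D) + (21 * D + (4 + (D + D)) * (suc (D * D) * (D * (D * D) + D)) * D)
        ≤⟨ +-mono-≤ (*-monoʳ-≤ 20 (m/n*n≤m k D)) (polynomial≤ D 0<D) ⟩
      20 * k + 45 * D ^ 7                          ≤⟨ +-monoʳ-≤ (20 * k) (*-monoʳ-≤ 45 (≤-trans (seventh-power≤ D 256≤D) (≤-trans 2^[D-1]≤n suc-n≤43k))) ⟩
      20 * k + 45 * (43 * k)                       ≡⟨ cong (λ z → 20 * k + z) (*-assoc 45 43 k) ⟨
      20 * k + 45 * 43 * k                         ≡⟨ *-distribʳ-+ k 20 (45 * 43) ⟨
      (20 + 45 * 43) * k                           ≤⟨ *-monoˡ-≤ k (≤-trans (≤ᵇ⇒≤ (20 + 45 * 43) (256 * 43) _) K-large) ⟩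
      K * k                                        ∎
      where
      open ≤-Reasoning
      instance
        _ = >-nonZero 0<D
      k<qD : k < suc (k / D) * D
      k<qD = ≤-<-trans (≤-reflexive (m≡m%n+[m/n]*n k D)) (+-monoˡ-< (k / D * D) (m%n<n k D))
      2+k≤ : 2 + k ≤ 2 ^ (D + D)
      2+k≤ = begin
        2 + k              ≤⟨ s≤s k<ND ⟩
        1 + suc n * D      ≤⟨ +-monoˡ-≤ (suc n * D) {1} {D} 0<D ⟩
        suc (suc n) * D    ≤⟨ *-mono-≤ n<2^D (<⇒≤ (n<2^n D)) ⟩
        2 ^ D * 2 ^ D      ≡⟨ ^-distribˡ-+-* 2 D D ⟨
        2 ^ (D + D)        ∎

    -- For D ≤ 256 the linear bound suffices, and for (n + 1) D ≤ k nothing is left to prove.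
    logarithms≤ : suc n * D ≤ K * k
    logarithms≤ = cases (D ≤? 256) (suc n * D ≤? k)
      where
      open ≤-Reasoning
      cases : Dec (D ≤ 256) → Dec (suc n * D ≤ k) → suc n * D ≤ K * k
      cases (yes D≤) _ = begin
        suc n * D           ≤⟨ *-mono-≤ suc-n≤43k D≤ ⟩
        43 * k * 256        ≡⟨ *-comm (43 * k) 256 ⟩
        256 * (43 * k)      ≡⟨ *-assoc 256 43 k ⟨
        256 * 43 * k        ≤⟨ *-monoˡ-≤ k K-large ⟩
        K * k               ∎
      cases (no D>) (yes l) = ≤-trans l (m≤n*m k K {{>-nonZero (≤-trans (s≤s z≤n) K-large)}})
      cases (no D>) (no g) = large-case (<⇒≤ (≰⇒> D>)) (≰⇒> g)

-- Upper bounds for products and logarithms of Dedekind reals.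

module Reals where
  open import Data.Nat.Base using (ℕ; zero; suc)
  open import Data.Rational.Base hiding (∣_∣)
  open import Data.Rational.Properties hiding (<-dense)
  open ℚ.+-*-Solver using (solve; _:+_; _:*_; _:-_; :-_; _:=_; con)
  open Exp (CommutativeRing.commutativeSemiring +-*-commutativeRing) using (_^_)
  open ℝ
  open Enclosure

  clip : ∀ x {l u r} → lower x l → upper x u → upper x r → ∃ λ v → l ≤ v × v ≤ u × v ≤ r × upper x v
  clip x {l} {u} {r} xl xu xr = pick (≤-total u r)
    where
    pick : u ≤ r ⊎ r ≤ u → ∃ λ v → l ≤ v × v ≤ u × v ≤ r × upper x v
    pick (inj₁ h) = u , <⇒≤ (lower<upper x xl xu) , ≤-refl , h , xu
    pick (inj₂ h) = r , <⇒≤ (lower<upper x xl xr) , h , ≤-refl , xr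

  scaled-lower : ∀ {c x N r} → 0ℚ < c → upper x N → lower (fromℚ c *ℝ x) r → r < c * N
  scaled-lower {c} {x} 0<c xN (B , r<) =
    let v , l , u , v≤N , _ = clip x (c<y B) (y<d B) xN
    in <-≤-trans r< (≤-trans (proj₁ (corners B (<⇒≤ (a<x B)) (<⇒≤ (x<b B)) l u)) (*≤ˡ (<⇒≤ 0<c) v≤N))

  scaled-upper : ∀ {c x r} → 0ℚ < c → 0ℝ <ℝ x → upper (fromℚ c *ℝ x) r → 0ℚ < r
  scaled-upper {c} {x} {r} 0<c (s , 0<s , xs) (B , <r) = pick (≤-total s (c′ B))
    where
    c′ : Enclosure (fromℚ c) x → ℚ
    c′ B = Enclosure.c B
    bound : ∀ v → 0ℚ < v → c′ B ≤ v → v ≤ d B → 0ℚ < r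
    bound v 0<v l u = <-trans (<-≤-trans (pos* 0<c 0<v) (proj₂ (corners B (<⇒≤ (a<x B)) (<⇒≤ (x<b B)) l u))) <r
    pick : s ≤ c′ B ⊎ c′ B ≤ s → 0ℚ < r
    pick (inj₁ h) = bound (c′ B) (<-≤-trans 0<s h) ≤-refl (<⇒≤ (lower<upper x (c<y B) (y<d B)))
    pick (inj₂ h) = bound s 0<s h (<⇒≤ (lower<upper x xs (y<d B)))

  -- Any enclosure of the factors contains a point (u , v) with 0 < u ≤ c N and v ≤ D, and its least
  -- corner is at most u v ≤ u D ≤ c N D. The real y may be negative, as log log 2 is, so signs are
  -- taken from u and D only.
  product-bound : ∀ {c x y N D b} → 0ℚ < c → 0ℝ <ℝ x → upper x N → upper y D → 0ℚ ≤ D →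
    c * N * D ≤ b → fromℚ c *ℝ x *ℝ y ≤ℝ fromℚ b
  product-bound {c} {x} {y} {N} {D} {b′} 0<c 0<x xN yD 0≤D h q (B , q<) =
    let v , vl , vu , v≤D , _ = clip y (c<y B) (y<d B) yD in choose v vl vu v≤D (≤-total (b B) (c * N))
    where
    finish : ∀ u v → 0ℚ < u → u ≤ c * N → v ≤ D → a B ≤ u → u ≤ b B → Enclosure.c B ≤ v → v ≤ d B → q < b′
    finish u v 0<u u≤ v≤ au ub cv vd = <-≤-trans q< (≤-trans (proj₁ (corners B au ub cv vd))
      (≤-trans (*≤ˡ (<⇒≤ 0<u) v≤) (≤-trans (*≤ʳ 0≤D u≤) h)))
    0<b : 0ℚ < b B
    0<b = scaled-upper {c} {x} 0<c 0<x (x<b B)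
    choose : ∀ v → Enclosure.c B ≤ v → v ≤ d B → v ≤ D → b B ≤ c * N ⊎ c * N ≤ b B → q < b′
    choose v vl vu v≤D (inj₁ h) = finish (b B) v 0<b h v≤D (<⇒≤ (lower<upper (fromℚ c *ℝ x) (a<x B) (x<b B))) ≤-refl vl vu
    choose v vl vu v≤D (inj₂ h) = finish (c * N) v 0<cN ≤-refl v≤D (<⇒≤ (scaled-lower {c} {x} 0<c xN (a<x B))) h vl vu
      where
      0<cN : 0ℚ < c * N
      0<cN = let s , 0<s , xs = 0<x in pos* 0<c (<-trans 0<s (lower<upper x xs xN))

  ι-< : ∀ {m n} → m ℕ.< n → ι m < ι n
  ι-< {m} {n} h = <-≤-trans (lt (subst (0ℚ <_) (trans (solve 1 (λ x → con 1ℚ := con 1ℚ :+ x :- x) refl (ι m)) (cong (_- ι m) (sym (ι-suc m)))) 0<1)) (ι-mono h)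

  ι-2^ : ∀ n → (1ℚ + 1ℚ) ^ n ≡ ι (2 ℕ.^ n)
  ι-2^ zero = refl
  ι-2^ (suc n) = trans (cong ((1ℚ + 1ℚ) *_) (ι-2^ n)) (sym (ι-* 2 (2 ℕ.^ n)))

  -- At this index the sequence increasing to e^(n + 1) has the term (1 + 1)^(n + 1), so 2^(n + 1) ≤
  -- e^(n + 1) comes without an estimate of e.
  compound-2^ : ∀ n → compound (ι (suc n)) n ≡ ι (2 ℕ.^ suc n)
  compound-2^ n = trans (cong (λ z → (1ℚ + z) ^ suc n) (ι-inv n)) (ι-2^ (suc n))

  2^-lower-exp : ∀ n {r} → r < ι (2 ℕ.^ suc n) → lower (exp (ι (suc n))) r
  2^-lower-exp n h = n , pos+ 0<1 (<⇒≤ (pos* (ι>0 n) (inv>0 n))) , subst (_ <_) (sym (compound-2^ n)) h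

  logℕ-upper : ∀ {p n} (1<p : 1 ℕ.< p) → p ℕ.< 2 ℕ.^ suc n → upper (logℕ p 1<p) (ι (suc n))
  logℕ-upper {p} {n} 1<p h = let r , p<r , r<2^n = <-dense (ι-< h) in r , p<r , 2^-lower-exp n r<2^n

  loglogℕ-upper : ∀ {p n d} (1<p : 1 ℕ.< p) → p ℕ.< 2 ℕ.^ suc n → suc n ℕ.< 2 ℕ.^ suc d → upper (loglogℕ p 1<p) (ι (suc d))
  loglogℕ-upper {p} {n} {d} 1<p h g = ι (suc n) , logℕ-upper {n = n} 1<p h , 2^-lower-exp d (ι-< g)

  inv-scale : ∀ K N D k → N ℕ.* D ℕ.≤ suc K ℕ.* k → inv K * ι N * ι D ≤ ι k
  inv-scale K N D k h = subst₂ _≤_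
    (trans (cong (inv K *_) (ι-* N D)) (sym (*-assoc (inv K) (ι N) (ι D))))
    (trans (cong (inv K *_) (ι-* (suc K) k)) (trans (sym (*-assoc (inv K) (ι (suc K)) (ι k)))
      (trans (cong (_* ι k) (trans (*-comm (inv K) (ι (suc K))) (ι-inv K))) (*-identityˡ (ι k)))))
    (*≤ˡ (<⇒≤ (inv>0 K)) (ι-mono h))

open import Data.Nat.Base using (ℕ; _≤_)
open import Data.Rational.Base using (_/_)
open Combinatorics using (prime≤; binary-log; logarithms≤)
open Reals using (product-bound; logℕ-upper; loglogℕ-upper; inv-scale)

-- Assembling the two bounds.

unit-fraction : ∀ K .{{_ : ℕ.NonZero K}} → + 1 / K ≡ inv (ℕ.pred K)
unit-fraction (ℕ.suc K) = refl

-- The coefficient is a variable because unfolding + 1 / 40000000010006048640 is slow.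
bounds : ∀ {c₀} (K : ℕ) → c₀ ≡ inv K → 256 ℕ.* 43 ≤ ℕ.suc K →
  (∀ (p : ℕ) (pr : Prime p) (A : Subset p) →
    2 ≤ ∣ A ∣ →
    NoUniqueSum (ℤ/ p {{prime⇒nonZero pr}}) (_∈ A) →
    fromℚ c₀ *ℝ logℕ p (prime>1 pr) *ℝ loglogℕ p (prime>1 pr) ≤ℝ fromℕ ∣ A ∣)
  ×
  (∃ λ (c : ℝ) → 0ℝ <ℝ c ×
    (∀ (p : ℕ) (pr : Prime p) (3≤p : 3 ≤ p) →
      c *ℝ logℕ p (prime>1 pr) *ℝ loglogℕ p (prime>1 pr) ≤ℝ fromℕ (m p pr 3≤p)))
bounds K refl K-large = size-bound , fromℚ (inv K) , <-dense (inv>0 K) , λ p pr 3≤p →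
  let (A , (2≤ , nus) , size) , _ = m-isMinimum p pr 3≤p
  in subst (λ k → fromℚ (inv K) *ℝ logℕ p (prime>1 pr) *ℝ loglogℕ p (prime>1 pr) ≤ℝ fromℕ k) size (size-bound p pr A 2≤ nus)
  where
  size-bound : ∀ p (pr : Prime p) (A : Subset p) → 2 ≤ ∣ A ∣ → NoUniqueSum (ℤ/ p {{prime⇒nonZero pr}}) (_∈ A) →
    fromℚ (inv K) *ℝ logℕ p (prime>1 pr) *ℝ loglogℕ p (prime>1 pr) ≤ℝ fromℕ ∣ A ∣
  size-bound p pr A 2≤k nus =
    -- The second logarithm is taken of n + 1, the upper bound for log p, so that d + 1 is an upper
    -- bound for log log p.
    let n , 2^n≤p , p<2^n = binary-log p (ℕ.<-trans ℕ.z<s (prime>1 pr))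
        d , 2^d≤n , n<2^d = binary-log (ℕ.suc n) ℕ.z<s
    in product-bound {inv K} {logℕ p (prime>1 pr)} {loglogℕ p (prime>1 pr)} (inv>0 K)
      (log>0 {fromℕ p} (fromℕ-< (ℕ.<-trans ℕ.z<s (prime>1 pr))) (fromℕ-< (prime>1 pr)))
      (logℕ-upper {n = n} (prime>1 pr) p<2^n) (loglogℕ-upper {n = n} {d} (prime>1 pr) p<2^n n<2^d) (ι≥0 (ℕ.suc d))
      (inv-scale K (ℕ.suc n) (ℕ.suc d) ∣ A ∣ (logarithms≤ {p} {∣ A ∣} {n} {ℕ.suc d} {ℕ.suc K} 2≤k
        (λ ℓ q 0<ℓ k<qℓ → prime≤ p {{prime⇒nonZero pr}} pr A nus ℓ q 0<ℓ k<qℓ (ℕ.<-≤-trans ℕ.z<s 2≤k))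
        2^n≤p ℕ.z<s 2^d≤n n<2^d K-large))

theorem1p1 : (∀ (p : ℕ) (pr : Prime p) (A : Subset p) →
    2 ≤ ∣ A ∣ →
    NoUniqueSum (ℤ/ p {{prime⇒nonZero pr}}) (_∈ A) →
    fromℚ (+ 1 / 40000000010006048640) *ℝ logℕ p (prime>1 pr) *ℝ loglogℕ p (prime>1 pr)
    ≤ℝ fromℕ ∣ A ∣)
    ×
    (∃ λ (c : ℝ) → 0ℝ <ℝ c ×
    (∀ (p : ℕ) (pr : Prime p) (3≤p : 3 ≤ p) →
    c *ℝ logℕ p (prime>1 pr) *ℝ loglogℕ p (prime>1 pr) ≤ℝ fromℕ (m p pr 3≤p)))
theorem1p1 = bounds 40000000010006048639 (unit-fraction 40000000010006048640)
  (ℕ.≤ᵇ⇒≤ (256 ℕ.* 43) 40000000010006048640 _)
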